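{- Let $\Delta=\Delta(f)$ be a positive integer and $\lambda=\lambda(f)>0$ a real number, both depending on a real parameter $f$, such that $f\le \Delta^2+1$ and, as $f\to\infty$, \[ \Delta\log(1+\lambda)\to\infty \quad\text{ and }\quad \frac{2(\Delta\log(1+\lambda))^2}{f\,W(\Delta\log(1+\lambda))}\to 0\,. \] Then there is a function $\delta(f)\to 0$ as $f\to\infty$ such that for every such $f$ and every graph $G$ of maximum degree $\Delta$ in which the neighbourhood of every vertex spans at most $\Delta^2/f$ edges, writing $\mathbf{I}$ for the random independent set from the hard-core model on $G$ at fugacity $\lambda$, \[ \frac{1}{|V(G)|}\mathbb{E}|\mathbf{I}| \ge (1+\delta(f))\frac{\lambda}{1+\lambda}\cdot\frac{W(\Delta\log(1+\lambda))}{\Delta\log(1+\lambda)}\,. \]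
   Context: $\log$ is the natural logarithm. $W:[-1/e,\infty)\to[-1,\infty)$ is the Lambert $W$ function, the inverse of $z\mapsto ze^z$. For a graph $G$ with set $\mathcal{I}(G)$ of independent sets (including the empty set) and $\lambda>0$, the hard-core model on $G$ at fugacity $\lambda$ is the probability distribution on $\mathcal{I}(G)$ with $\Pr(\mathbf{I}=I)=\lambda^{|I|}/Z_G(\lambda)$, where $Z_G(\lambda)=\sum_{I\in\mathcal{I}(G)}\lambda^{|I|}$. "The neighbourhood of a vertex $v$ spans at most $m$ edges" means the subgraph induced by $N(v)$ has at most $m$ edges. -}

module Defs where

open import Algebra.Bundles using (CommutativeRing)
import Algebra.Properties.Semiring.Exp
import Algebra.Properties.Semiring.Mult
import Algebra.Properties.Semiring.Sum
open import Data.Bool.Base using (true; false)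
open import Data.Fin.Base using (Fin; toℕ)
import Data.Fin.Properties as Fin
open import Data.Fin.Subset using (Subset; _∈_; ∣_∣)
open import Data.Fin.Subset.Properties using (_∈?_)
open import Data.List.Base as List using (List; []; _∷_; _++_; allFin; cartesianProduct; filter; foldr)
open import Data.List.Extrema.Nat using (max)
open import Data.Nat.Base as ℕ using (ℕ; zero; suc; _!)
open import Data.Product.Base using (_×_; _,_; ∃; ∃-syntax)
open import Data.Vec.Base as Vec using (tabulate)
open import Level using (0ℓ)
open import Relation.Binary.Bundles using (DecTotalOrder)
import Relation.Binary.Construct.NonStrictToStrict as ToStrict
open import Relation.Binary.Core using (Rel)
open import Relation.Binary.Definitions using (Decidable; Irreflexive; Symmetric)
open import Relation.Binary.PropositionalEquality using (_≡_)
open import Relation.Binary.Structures using (IsDecTotalOrder)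
open import Relation.Nullary using (¬_; Dec; does)
open import Relation.Nullary.Decidable using (¬?; _→-dec_; _×-dec_)
open import Relation.Unary using (Pred; U)

------------------------------------------------------------------------
-- The real numbers, as a Dedekind-complete ordered field.  These axioms
-- determine ℝ up to unique isomorphism.  The order is decidable because
-- the reals meant here are the classical ones.

record RealNumbers : Set₁ where
  infix  4 _≤_
  infix  8 _⁻¹
  field
    commutativeRing : CommutativeRing 0ℓ 0ℓ

  open CommutativeRing commutativeRing public renaming (setoid to ℝ-setoid)

  field
    _≤_             : Rel Carrier 0ℓ
    isDecTotalOrder : IsDecTotalOrder _≈_ _≤_
    +-monoˡ-≤       : ∀ z {x y} → x ≤ y → x + z ≤ y + z
    *-nonNeg        : ∀ {x y} → 0# ≤ x → 0# ≤ y → 0# ≤ x * y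
    0≉1             : ¬ 0# ≈ 1#
    -- Total, with an unspecified value at 0.
    _⁻¹             : Carrier → Carrier
    ⁻¹-cong         : ∀ {x y} → x ≈ y → x ⁻¹ ≈ y ⁻¹
    *-inverseʳ      : ∀ {x} → ¬ x ≈ 0# → x * x ⁻¹ ≈ 1#

  UpperBound : Pred Carrier 0ℓ → Pred Carrier 0ℓ
  UpperBound P u = ∀ x → P x → x ≤ u

  field
    supremum : (P : Pred Carrier 0ℓ) → ∃ P → ∃ (UpperBound P) →
               ∃[ s ] UpperBound P s × (∀ u → UpperBound P u → s ≤ u)

  ℝ : Set
  ℝ = Carrier

  ℝ-decTotalOrder : DecTotalOrder 0ℓ 0ℓ 0ℓ
  ℝ-decTotalOrder = record { isDecTotalOrder = isDecTotalOrder }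

  infix 4 _<_
  _<_ : Rel ℝ 0ℓ
  _<_ = ToStrict._<_ _≈_ _≤_

  infixl 7 _/_
  _/_ : ℝ → ℝ → ℝ
  x / y = x * y ⁻¹

  open Algebra.Properties.Semiring.Exp semiring public using (_^_)
  open Algebra.Properties.Semiring.Sum semiring public using (sum)

  fromℕ : ℕ → ℝ
  fromℕ n = n Mult.× 1#
    where module Mult = Algebra.Properties.Semiring.Mult semiring

------------------------------------------------------------------------
-- Limits and the special functions

module RealAnalysis (R : RealNumbers) where

  open RealNumbers R

  infix 4 ∣_∣<_
  ∣_∣<_ : ℝ → ℝ → Set
  ∣ x ∣< ε = (- ε < x) × (x < ε)

  SequenceTendsTo : (ℕ → ℝ) → ℝ → Set
  SequenceTendsTo a l = ∀ ε → 0# < ε → ∃[ N ] ∀ n → N ℕ.≤ n → ∣ a n - l ∣< ε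

  -- Behaviour of g f as the real variable f tends to +∞.
  TendsToZero : (ℝ → ℝ) → Set
  TendsToZero g = ∀ ε → 0# < ε → ∃[ F ] ∀ f → F < f → ∣ g f ∣< ε

  TendsToInfinity : (ℝ → ℝ) → Set
  TendsToInfinity g = ∀ M → ∃[ F ] ∀ f → F < f → M < g f

  expPartialSum : ℝ → ℕ → ℝ
  expPartialSum x n = sum {n} λ k → x ^ toℕ k / fromℕ (toℕ k !)

  IsExp : (ℝ → ℝ) → Set
  IsExp exp = ∀ x → SequenceTendsTo (expPartialSum x) (exp x)

  -- g restricted to E is the inverse of the bijection f : D → E.
  -- Nothing is said about values outside D and E.
  record InverseOn (D E : Pred ℝ 0ℓ) (f g : ℝ → ℝ) : Set where
    field
      f-maps   : ∀ {x} → D x → E (f x)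
      g-maps   : ∀ {y} → E y → D (g y)
      g-cong   : ∀ {y z} → E y → E z → y ≈ z → g y ≈ g z
      inverseˡ : ∀ {y} → E y → f (g y) ≈ y
      inverseʳ : ∀ {x} → D x → g (f x) ≈ x

-- Each of exp, log and W is determined on its domain by its definition:
-- the exponential series, and the inverses of z ↦ e^z : ℝ → (0,∞) and
-- z ↦ z e^z : [-1,∞) → [-1/e,∞).  Values elsewhere are unspecified.
record ElementaryFunctions (R : RealNumbers) : Set where
  open RealNumbers R
  open RealAnalysis R
  field
    exp log W : ℝ → ℝ
    exp-def   : IsExp exp
    log-def   : InverseOn U (0# <_) exp log
    W-def     : InverseOn (- 1# ≤_) (- (1# / exp 1#) ≤_) (λ z → z * exp z) W

------------------------------------------------------------------------
-- Finite simple graphs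

record Graph : Set₁ where
  infix 4 _~_ _~?_
  field
    order    : ℕ
    _~_      : Rel (Fin order) 0ℓ
    _~?_     : Decidable _~_
    ~-sym    : Symmetric _~_
    ~-irrefl : Irreflexive _≡_ _~_

  Vertex : Set
  Vertex = Fin order

  neighbourhood : Vertex → Subset order
  neighbourhood v = tabulate λ u → does (v ~? u)

  degree : Vertex → ℕ
  degree v = ∣ neighbourhood v ∣

  maxDegree : ℕ
  maxDegree = max 0 (List.map degree (allFin order))

  -- The edges of the subgraph induced by S, each listed once as a pair
  -- (u , v) with u < v.
  inducedEdges : Subset order → List (Vertex × Vertex)
  inducedEdges S =
    filter (λ (u , v) → (u Fin.<? v) ×-dec (u ∈? S) ×-dec (v ∈? S) ×-dec (u ~? v))
           (cartesianProduct (allFin order) (allFin order))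

  Independent : Subset order → Set
  Independent I = ∀ u → u ∈ I → ∀ v → v ∈ I → ¬ u ~ v

  independent? : ∀ I → Dec (Independent I)
  independent? I =
    Fin.all? λ u → (u ∈? I) →-dec Fin.all? λ v → (v ∈? I) →-dec ¬? (u ~? v)

-- Every subset of Fin n, listed exactly once.
subsets : ∀ n → List (Subset n)
subsets zero    = Vec.[] ∷ []
subsets (suc n) = List.map (true Vec.∷_) (subsets n) ++ List.map (false Vec.∷_) (subsets n)

------------------------------------------------------------------------
-- The hard-core model

module HardCore (R : RealNumbers) (G : Graph) where

  open RealNumbers R
  open Graph G

  independentSets : List (Subset order)
  independentSets = filter independent? (subsets order)

  Σ-independent : (Subset order → ℝ) → ℝ
  Σ-independent g = foldr (λ I s → g I + s) 0# independentSets

  Z : ℝ → ℝ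
  Z fugacity = Σ-independent λ I → fugacity ^ ∣ I ∣

  Pr : ℝ → Subset order → ℝ
  Pr fugacity I = fugacity ^ ∣ I ∣ / Z fugacity

  𝔼 : ℝ → (Subset order → ℝ) → ℝ
  𝔼 fugacity X = Σ-independent λ I → Pr fugacity I * X I

{-# OPTIONS --safe #-}
-- Write L = log (1 + λ), D = Δ L and w = W(D), so that w e^w = D.  For a vertex v let Y be
-- the number of its neighbours u that are uncovered, i.e. have no neighbour in I outside N(v).
-- Conditioned on I ∖ N(v), the neighbourhood of v is empty with probability at least
-- (1 + λ)^(−Y) = e^(−L Y) ≥ e^(−w) (1 + w − L Y), the tangent at w.  An uncovered u fails to
-- satisfy N(u) ∩ I = ∅ only through an edge inside N(v), and P(u ∈ I) = λ/(1+λ) P(N(u) ∩ I = ∅)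
-- with λ/(1+λ) ≤ L, so E Y ≤ Σ_{u ∼ v} P(N(u) ∩ I = ∅) + 2 m L when N(v) spans at most m edges.
-- Summing over v gives e^w (1 + w) Σ_v P(N(v) ∩ I = ∅) ≥ n (1 + w − 2 m L²), and
-- m = Δ²/f makes 2 m L² = 2 D²/f; thus δ = −2 D²/(f w) works.
--
-- The exponential enters through two consequences of its series on [0,∞): the tangent
-- inequality (1 + (a − b)) e^b ≤ e^a, and e^a e^b ≤ e^(a + b), which follows from the former by
-- subdividing a into small steps.
module Submission where

open import Defs
open import Data.Fin.Subset using (∣_∣)
open import Data.List.Base using (length)
open import Data.Nat.Base as ℕ using (ℕ)
open import Data.Product.Base using (_×_; Σ-syntax)
open import Function.Bundles using (Func; _⟨$⟩_)
open import Relation.Binary.PropositionalEquality using (_≡_; setoid)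

open import Algebra.Bundles using (RawRing)
import Algebra.Properties.AbelianGroup
import Algebra.Properties.CommutativeSemigroup
import Algebra.Properties.Ring
import Algebra.Properties.Semiring.Mult
import Algebra.Properties.Semiring.Mult.TCOptimised
import Algebra.Solver.Ring
open import Algebra.Solver.Ring.AlmostCommutativeRing using (fromCommutativeRing; _-Raw-AlmostCommutative⟶_)
open import Data.Bool.Base using (Bool; true; false; if_then_else_; _∧_)
open import Data.Empty using (⊥-elim)
open import Data.Fin.Base as Fin using (Fin; toℕ)
import Data.Fin.Properties as Fin
open import Data.Fin.Subset using (Subset; _∈_; ⊥)
open import Data.Fin.Subset.Properties using (_∈?_; ∉⊥; ∣⊥∣≡0)
open import Data.List.Base as List using (List; []; _∷_; _++_; allFin; cartesianProduct; filter; foldr)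
open import Data.List.Extrema.Nat using (xs≤max)
import Data.List.Membership.Propositional as List∈
import Data.List.Membership.Propositional.Properties as List∈
import Data.List.Properties as List
import Data.List.Relation.Unary.All as All
open import Data.List.Relation.Unary.Any using (here; there)
open import Data.Maybe.Base using (Maybe; just; nothing)
open import Data.Nat.Base using (zero; suc; _!)
import Data.Nat.Properties as ℕ
open import Data.Product.Base using (_,_; proj₁; proj₂; ∃-syntax)
open import Data.Sum.Base using (_⊎_; inj₁; inj₂)
open import Data.Unit.Base using (tt)
open import Data.Vec.Base as Vec using (lookup; _[_]≔_)
import Data.Vec.Properties as Vec
open import Function.Bundles using (mk⇔)
open import Level using (0ℓ)
open import Relation.Binary.Bundles using (DecTotalOrder)
import Relation.Binary.Construct.NonStrictToStrict
import Relation.Binary.Properties.DecTotalOrder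
import Relation.Binary.PropositionalEquality as ≡
import Relation.Binary.Reasoning.PartialOrder
import Relation.Binary.Reasoning.Setoid
open import Relation.Binary.Definitions using (tri<; tri≈; tri>)
open import Relation.Nullary using (¬_; Dec; yes; no; does)
open import Relation.Nullary.Decidable using (¬?; _→-dec_; _×-dec_; dec-true; does-⇔)
open import Relation.Unary using (Pred; Decidable)

-- The point w is the best one for the tangent. Write T for the sum of P(N(v) ∩ I = ∅) over v. For
-- any w ≥ 0 the averaged inequality reads n (1 + w - 2 m L²) ≤ (e^w + D) T, since T enters once
-- through the vertices and once, with factor Δ L = D, through their neighbours. Up to the edge term
-- the resulting bound is n (1 + w) / (e^w + D), which is largest where w e^w = D, with value n
-- e^(-w) = n w / D there: this is the origin of W(D) / D.
--
-- No conditional probability is formed. Conditioning becomes a pairing of I with I ∪ {u} inside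
-- sums over all subsets: for one neighbour u of v at a time, the factor 1 / (1 + λ) of an uncovered
-- u is exchanged for the indicator that u is vacant. Expectations stay unnormalised, and Z is
-- divided out only at the end.
--
-- The series controls exponentials at nonnegative arguments only, so bounds that involve e^(-L Y)
-- or e^(-w) are stated multiplied out by e^(L Y) or e^w.

-- A ring solver with integer coefficients

module RingSolver (R : RealNumbers) where

  open RealNumbers R hiding (zero)
  open Algebra.Properties.Ring ring using (-‿distribˡ-*; -‿distribʳ-*; -0#≈0#; -‿involutive)
  open Algebra.Properties.AbelianGroup +-abelianGroup using (⁻¹-∙-comm)
  open Algebra.Properties.CommutativeSemigroup +-commutativeSemigroup using (interchange)
  open Relation.Binary.Reasoning.Setoid ℝ-setoid
  open Algebra.Properties.Semiring.Mult.TCOptimised semiring using (×-homo-+; ×1-homo-*; 1+×) renaming (_×_ to _·_)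

  -- The pair (m , n) stands for the integer m − n.  Sums and products are
  -- kept in lowest terms so that cancelling coefficients really vanish.
  reduce : ℕ → ℕ → ℕ × ℕ
  reduce (suc m) (suc n) = reduce m n
  reduce m       n       = m , n

  differences : RawRing _ _
  differences = record
    { Carrier = ℕ × ℕ
    ; _≈_     = _≡_
    ; _+_     = λ (a , b) (c , d) → reduce (a ℕ.+ c) (b ℕ.+ d)
    ; _*_     = λ (a , b) (c , d) → reduce (a ℕ.* c ℕ.+ b ℕ.* d) (a ℕ.* d ℕ.+ b ℕ.* c)
    ; -_      = λ (a , b) → b , a
    ; 0#      = 0 , 0
    ; 1#      = 1 , 0
    }

  -- The clause for n = 0 makes (0 , 0) and (1 , 0) denote 0# and 1# definitionally.
  value : ℕ × ℕ → ℝ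
  value (a , zero)      = a · 1#
  value (a , b@(suc _)) = a · 1# - b · 1#

  value-≈ : ∀ a b → value (a , b) ≈ a · 1# - b · 1#
  value-≈ a zero    = sym (trans (+-congˡ -0#≈0#) (+-identityʳ _))
  value-≈ a (suc b) = refl

  value-reduce : ∀ a b → value (reduce a b) ≈ a · 1# - b · 1#
  value-reduce (suc a) (suc b) = begin
    value (reduce a b)                      ≈⟨ value-reduce a b ⟩
    a · 1# - b · 1#                         ≈⟨ +-identityˡ _ ⟨
    0# + (a · 1# - b · 1#)                  ≈⟨ +-congʳ (-‿inverseʳ 1#) ⟨
    (1# - 1#) + (a · 1# - b · 1#)           ≈⟨ interchange _ _ _ _ ⟩
    (1# + a · 1#) + (- 1# + - (b · 1#))     ≈⟨ +-congˡ (⁻¹-∙-comm _ _) ⟩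
    (1# + a · 1#) - (1# + b · 1#)           ≈⟨ +-cong (1+× a 1#) (-‿cong (1+× b 1#)) ⟨
    suc a · 1# - suc b · 1#                 ∎
  value-reduce zero    b       = value-≈ 0 b
  value-reduce (suc a) zero    = value-≈ (suc a) 0

  value-+ : ∀ p q → value (RawRing._+_ differences p q) ≈ value p + value q
  value-+ (a , b) (c , d) = begin
    value (reduce (a ℕ.+ c) (b ℕ.+ d))               ≈⟨ value-reduce (a ℕ.+ c) (b ℕ.+ d) ⟩
    (a ℕ.+ c) · 1# - (b ℕ.+ d) · 1#                ≈⟨ +-cong (×-homo-+ 1# a c) (-‿cong (×-homo-+ 1# b d)) ⟩
    (a · 1# + c · 1#) - (b · 1# + d · 1#)          ≈⟨ +-congˡ (⁻¹-∙-comm _ _) ⟨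
    (a · 1# + c · 1#) + (- (b · 1#) + - (d · 1#))  ≈⟨ interchange _ _ _ _ ⟩
    (a · 1# - b · 1#) + (c · 1# - d · 1#)          ≈⟨ +-cong (value-≈ a b) (value-≈ c d) ⟨
    value (a , b) + value (c , d)                  ∎

  value-* : ∀ p q → value (RawRing._*_ differences p q) ≈ value p * value q
  value-* (a , b) (c , d) = begin
    value (reduce (a ℕ.* c ℕ.+ b ℕ.* d) (a ℕ.* d ℕ.+ b ℕ.* c))  ≈⟨ value-reduce (a ℕ.* c ℕ.+ b ℕ.* d) (a ℕ.* d ℕ.+ b ℕ.* c) ⟩
    (a ℕ.* c ℕ.+ b ℕ.* d) · 1# - (a ℕ.* d ℕ.+ b ℕ.* c) · 1#
      ≈⟨ +-cong (hom a c b d) (-‿cong (hom a d b c)) ⟩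
    (A * C + B * D) - (A * D + B * C)                  ≈⟨ +-congˡ (⁻¹-∙-comm _ _) ⟨
    (A * C + B * D) + (- (A * D) + - (B * C))          ≈⟨ +-congˡ (+-comm _ _) ⟩
    (A * C + B * D) + (- (B * C) + - (A * D))          ≈⟨ interchange _ _ _ _ ⟩
    (A * C - B * C) + (B * D - A * D)                  ≈⟨ +-cong (+-congˡ (-‿distribˡ-* B C)) (+-comm _ _) ⟩
    (A * C + - B * C) + (- (A * D) + B * D)            ≈⟨ +-cong (sym (distribʳ C A (- B))) (+-cong (-‿distribʳ-* A D) (trans (sym (-‿involutive _)) (trans (-‿cong (-‿distribˡ-* B D)) (-‿distribʳ-* (- B) D)))) ⟩
    (A - B) * C + (A * - D + - B * - D)                ≈⟨ +-congˡ (distribʳ (- D) A (- B)) ⟨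
    (A - B) * C + (A - B) * - D                        ≈⟨ distribˡ (A - B) C (- D) ⟨
    (A - B) * (C - D)                                  ≈⟨ *-cong (value-≈ a b) (value-≈ c d) ⟨
    value (a , b) * value (c , d)                      ∎
    where
    A = a · 1#
    B = b · 1#
    C = c · 1#
    D = d · 1#
    hom : ∀ a c b d → (a ℕ.* c ℕ.+ b ℕ.* d) · 1# ≈ a · 1# * c · 1# + b · 1# * d · 1#
    hom a c b d = trans (×-homo-+ 1# (a ℕ.* c) (b ℕ.* d)) (+-cong (×1-homo-* a c) (×1-homo-* b d))

  value-neg : ∀ p → value (RawRing.-_ differences p) ≈ - value p
  value-neg (a , b) = begin
    value (b , a)               ≈⟨ value-≈ b a ⟩
    b · 1# - a · 1#             ≈⟨ +-comm _ _ ⟩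
    - (a · 1#) + b · 1#         ≈⟨ +-congˡ (-‿involutive _) ⟨
    - (a · 1#) + - - (b · 1#)   ≈⟨ ⁻¹-∙-comm _ _ ⟩
    - (a · 1# - b · 1#)         ≈⟨ -‿cong (value-≈ a b) ⟨
    - value (a , b)             ∎

  value-hom : differences -Raw-AlmostCommutative⟶ fromCommutativeRing commutativeRing
  value-hom = record
    { ⟦_⟧    = value
    ; +-homo = value-+
    ; *-homo = value-*
    ; -‿homo = value-neg
    ; 0-homo = refl
    ; 1-homo = refl
    }

  cross : ∀ {x y z w} → x + w ≈ z + y → x - y ≈ z - w
  cross {x} {y} {z} {w} eq = begin
    x - y                   ≈⟨ +-identityʳ _ ⟨
    (x - y) + 0#            ≈⟨ +-congˡ (-‿inverseʳ w) ⟨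
    (x + - y) + (w + - w)   ≈⟨ interchange _ _ _ _ ⟩
    (x + w) + (- y + - w)   ≈⟨ +-cong eq (+-comm _ _) ⟩
    (z + y) + (- w + - y)   ≈⟨ interchange _ _ _ _ ⟩
    (z - w) + (y - y)       ≈⟨ +-congˡ (-‿inverseʳ y) ⟩
    (z - w) + 0#            ≈⟨ +-identityʳ _ ⟩
    z - w                   ∎

  -- Equality on ℝ is decidable, but the decision does not compute for an abstract field.
  -- Coefficients are therefore compared as integers, by cross addition in ℕ.
  value-≟ : ∀ p q → Maybe (value p ≈ value q)
  value-≟ (a , b) (c , d) with a ℕ.+ d ℕ.≟ c ℕ.+ b
  ... | no _   = nothing
  ... | yes eq = just (trans (value-≈ a b) (trans (cross (begin
    a · 1# + d · 1#   ≈⟨ ×-homo-+ 1# a d ⟨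
    (a ℕ.+ d) · 1#    ≡⟨ ≡.cong (_· 1#) eq ⟩
    (c ℕ.+ b) · 1#    ≈⟨ ×-homo-+ 1# c b ⟩
    c · 1# + b · 1#   ∎)) (sym (value-≈ c d))))

  open Algebra.Solver.Ring differences (fromCommutativeRing commutativeRing) value-hom value-≟ public
    using (Polynomial; solve; con; _:+_; _:*_; _:-_; :-_; _:=_)

  :0 :1 : ∀ {n} → Polynomial n
  :0 = con (0 , 0)
  :1 = con (1 , 0)

-- Ordered fields and the Archimedean property

module OrderedField (R : RealNumbers) where

  open RealNumbers R hiding (zero)
  open RingSolver R
  open DecTotalOrder ℝ-decTotalOrder public
    using (_≤?_; total; poset)
    renaming (refl to ≤-refl; trans to ≤-trans; antisym to ≤-antisym; reflexive to ≤-reflexive)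
  open Relation.Binary.Properties.DecTotalOrder ℝ-decTotalOrder public
    using (<⇒≱; ≰⇒>; ≮⇒≥)
  open Relation.Binary.Construct.NonStrictToStrict _≈_ _≤_ public using (<⇒≤)
  module ≤-Reasoning = Relation.Binary.Reasoning.PartialOrder poset
  open ≤-Reasoning
  private module Mult = Algebra.Properties.Semiring.Mult semiring

  -- The usual route to a polynomial inequality below: a nonnegative gap `d` is exhibited, and the
  -- ring solver checks the identity.
  ≤-byDifference : ∀ {x y d} → 0# ≤ d → x + d ≈ y → x ≤ y
  ≤-byDifference {x} {y} {d} 0≤d eq = begin
    x       ≈⟨ +-identityˡ x ⟨
    0# + x  ≤⟨ +-monoˡ-≤ x 0≤d ⟩
    d + x   ≈⟨ +-comm d x ⟩
    x + d   ≈⟨ eq ⟩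
    y       ∎

  ≤-<-trans : ∀ {x y z} → x ≤ y → y < z → x < z
  ≤-<-trans {x} {y} {z} x≤y y<z = begin-strict
    x  ≤⟨ x≤y ⟩
    y  <⟨ y<z ⟩
    z  ∎

  common-upper : ∀ x y → ∃[ z ] x ≤ z × y ≤ z
  common-upper x y with total x y
  ... | inj₁ x≤y = y , x≤y , ≤-refl
  ... | inj₂ y≤x = x , ≤-refl , y≤x

  ≤⇒0≤- : ∀ {x y} → x ≤ y → 0# ≤ y - x
  ≤⇒0≤- {x} {y} x≤y = begin
    0#     ≈⟨ -‿inverseʳ x ⟨
    x - x  ≤⟨ +-monoˡ-≤ (- x) x≤y ⟩
    y - x  ∎

  0≤-⇒≤ : ∀ {x y} → 0# ≤ y - x → x ≤ y
  0≤-⇒≤ {x} {y} 0≤y-x = ≤-byDifference 0≤y-x (solve 2 (λ x y → x :+ (y :- x) := y) refl x y)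

  +-mono-≤ : ∀ {x y u v} → x ≤ y → u ≤ v → x + u ≤ y + v
  +-mono-≤ {x} {y} {u} {v} x≤y u≤v = begin
    x + u  ≤⟨ +-monoˡ-≤ u x≤y ⟩
    y + u  ≈⟨ +-comm y u ⟩
    u + y  ≤⟨ +-monoˡ-≤ y u≤v ⟩
    v + y  ≈⟨ +-comm v y ⟩
    y + v  ∎

  +-nonNeg : ∀ {x y} → 0# ≤ x → 0# ≤ y → 0# ≤ x + y
  +-nonNeg {x} {y} 0≤x 0≤y = begin
    0#       ≈⟨ +-identityʳ 0# ⟨
    0# + 0#  ≤⟨ +-mono-≤ 0≤x 0≤y ⟩
    x + y    ∎

  neg-mono-≤ : ∀ {x y} → x ≤ y → - y ≤ - x
  neg-mono-≤ {x} {y} x≤y = ≤-byDifference (≤⇒0≤- x≤y) (solve 2 (λ x y → :- y :+ (y :- x) := :- x) refl x y)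

  neg-mono-< : ∀ {x y} → x < y → - y < - x
  neg-mono-< {x} {y} (x≤y , x≉y) = neg-mono-≤ x≤y , λ eq → x≉y (begin-equality
    x      ≈⟨ solve 1 (λ x → x := :- :- x) refl x ⟩
    - - x  ≈⟨ -‿cong eq ⟨
    - - y  ≈⟨ solve 1 (λ x → :- :- x := x) refl y ⟩
    y      ∎)

  *-monoʳ-≤ : ∀ {x y z} → 0# ≤ z → x ≤ y → z * x ≤ z * y
  *-monoʳ-≤ {x} {y} {z} 0≤z x≤y = ≤-byDifference (*-nonNeg 0≤z (≤⇒0≤- x≤y))
    (solve 3 (λ x y z → z :* x :+ z :* (y :- x) := z :* y) refl x y z)

  *-monoˡ-≤ : ∀ {x y z} → 0# ≤ z → x ≤ y → x * z ≤ y * z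
  *-monoˡ-≤ {x} {y} {z} 0≤z x≤y = begin
    x * z  ≈⟨ *-comm x z ⟩
    z * x  ≤⟨ *-monoʳ-≤ 0≤z x≤y ⟩
    z * y  ≈⟨ *-comm z y ⟩
    y * z  ∎

  *-mono-≤ : ∀ {x y u v} → 0# ≤ x → 0# ≤ v → x ≤ y → u ≤ v → x * u ≤ y * v
  *-mono-≤ 0≤x 0≤v x≤y u≤v = ≤-trans (*-monoʳ-≤ 0≤x u≤v) (*-monoˡ-≤ 0≤v x≤y)

  square-nonNeg : ∀ x → 0# ≤ x * x
  square-nonNeg x with total 0# x
  ... | inj₁ 0≤x = *-nonNeg 0≤x 0≤x
  ... | inj₂ x≤0 = begin
    0#          ≤⟨ *-nonNeg 0≤-x 0≤-x ⟩
    - x * - x   ≈⟨ solve 1 (λ x → :- x :* :- x := x :* x) refl x ⟩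
    x * x       ∎
    where
    0≤-x : 0# ≤ - x
    0≤-x = begin
      0#      ≤⟨ ≤⇒0≤- x≤0 ⟩
      0# - x  ≈⟨ +-identityˡ (- x) ⟩
      - x     ∎

  0≤1 : 0# ≤ 1#
  0≤1 = ≤-trans (square-nonNeg 1#) (≤-reflexive (*-identityˡ 1#))

  0<1 : 0# < 1#
  0<1 = 0≤1 , 0≉1

  0<⇒≉0 : ∀ {x} → 0# < x → ¬ x ≈ 0#
  0<⇒≉0 (_ , 0≉x) x≈0 = 0≉x (sym x≈0)

  *-inverseˡ : ∀ {x} → ¬ x ≈ 0# → x ⁻¹ * x ≈ 1#
  *-inverseˡ x≉0 = trans (*-comm _ _) (*-inverseʳ x≉0)

  ⁻¹-nonNeg : ∀ {x} → 0# < x → 0# ≤ x ⁻¹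
  ⁻¹-nonNeg {x} 0<x with total 0# (x ⁻¹)
  ... | inj₁ 0≤x⁻¹ = 0≤x⁻¹
  ... | inj₂ x⁻¹≤0 = ⊥-elim (<⇒≱ 0<1 (begin
    1#          ≈⟨ *-inverseʳ (0<⇒≉0 0<x) ⟨
    x * x ⁻¹    ≤⟨ *-monoʳ-≤ (<⇒≤ 0<x) x⁻¹≤0 ⟩
    x * 0#      ≈⟨ zeroʳ x ⟩
    0#          ∎))

  *-cancelˡ-≤ : ∀ {x y z} → 0# < z → z * x ≤ z * y → x ≤ y
  *-cancelˡ-≤ {x} {y} {z} 0<z zx≤zy = begin
    x               ≈⟨ unit x ⟨
    z ⁻¹ * (z * x)  ≤⟨ *-monoʳ-≤ (⁻¹-nonNeg 0<z) zx≤zy ⟩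
    z ⁻¹ * (z * y)  ≈⟨ unit y ⟩
    y               ∎
    where
    unit : ∀ x → z ⁻¹ * (z * x) ≈ x
    unit x = begin-equality
      z ⁻¹ * (z * x)  ≈⟨ *-assoc _ _ _ ⟨
      z ⁻¹ * z * x    ≈⟨ *-congʳ (*-inverseˡ (0<⇒≉0 0<z)) ⟩
      1# * x          ≈⟨ *-identityˡ x ⟩
      x               ∎

  *-pos : ∀ {x y} → 0# < x → 0# < y → 0# < x * y
  *-pos {x} {y} 0<x 0<y = *-nonNeg (<⇒≤ 0<x) (<⇒≤ 0<y) , λ 0≈xy →
    <⇒≱ 0<y (*-cancelˡ-≤ 0<x (≤-reflexive (trans (sym 0≈xy) (sym (zeroʳ x)))))

  +-pos-nonNeg : ∀ {x y} → 0# < x → 0# ≤ y → 0# < x + y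
  +-pos-nonNeg {x} {y} 0<x 0≤y = begin-strict
    0#       <⟨ 0<x ⟩
    x        ≤⟨ ≤-byDifference 0≤y refl ⟩
    x + y    ∎

  ⁻¹-pos : ∀ {x} → 0# < x → 0# < x ⁻¹
  ⁻¹-pos {x} 0<x = ⁻¹-nonNeg 0<x , λ 0≈x⁻¹ → 0≉1 (begin-equality
    0#         ≈⟨ zeroʳ x ⟨
    x * 0#     ≈⟨ *-congˡ 0≈x⁻¹ ⟩
    x * x ⁻¹   ≈⟨ *-inverseʳ (0<⇒≉0 0<x) ⟩
    1#         ∎)

  /-*-cancel : ∀ x {y} → ¬ y ≈ 0# → (x / y) * y ≈ x
  /-*-cancel x {y} y≉0 = begin-equality
    x * y ⁻¹ * y    ≈⟨ *-assoc _ _ _ ⟩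
    x * (y ⁻¹ * y)  ≈⟨ *-congˡ (*-inverseˡ y≉0) ⟩
    x * 1#          ≈⟨ *-identityʳ x ⟩
    x               ∎

  ⁻¹-unique : ∀ {x y} → ¬ x ≈ 0# → x * y ≈ 1# → y ≈ x ⁻¹
  ⁻¹-unique {x} {y} x≉0 xy≈1 = begin-equality
    y                ≈⟨ *-identityˡ y ⟨
    1# * y           ≈⟨ *-congʳ (*-inverseˡ x≉0) ⟨
    x ⁻¹ * x * y     ≈⟨ *-assoc _ _ _ ⟩
    x ⁻¹ * (x * y)   ≈⟨ *-congˡ xy≈1 ⟩
    x ⁻¹ * 1#        ≈⟨ *-identityʳ _ ⟩
    x ⁻¹             ∎

  ⁻¹-distrib-* : ∀ {x y} → 0# < x → 0# < y → (x * y) ⁻¹ ≈ x ⁻¹ * y ⁻¹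
  ⁻¹-distrib-* {x} {y} 0<x 0<y = sym (⁻¹-unique (0<⇒≉0 (*-pos 0<x 0<y)) (begin-equality
    x * y * (x ⁻¹ * y ⁻¹)      ≈⟨ solve 4 (λ x y u v → x :* y :* (u :* v) := (x :* u) :* (y :* v)) refl x y (x ⁻¹) (y ⁻¹) ⟩
    (x * x ⁻¹) * (y * y ⁻¹)    ≈⟨ *-cong (*-inverseʳ (0<⇒≉0 0<x)) (*-inverseʳ (0<⇒≉0 0<y)) ⟩
    1# * 1#                    ≈⟨ *-identityˡ 1# ⟩
    1#                         ∎))

  fromℕ-nonNeg : ∀ n → 0# ≤ fromℕ n
  fromℕ-nonNeg zero    = ≤-refl
  fromℕ-nonNeg (suc n) = +-nonNeg 0≤1 (fromℕ-nonNeg n)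

  fromℕ-pos : ∀ {n} → 1 ℕ.≤ n → 0# < fromℕ n
  fromℕ-pos {suc n} _ = +-pos-nonNeg 0<1 (fromℕ-nonNeg n)

  fromℕ-mono-≤ : ∀ {m n} → m ℕ.≤ n → fromℕ m ≤ fromℕ n
  fromℕ-mono-≤ {m} m≤n with ℕ.m≤n⇒∃[o]m+o≡n m≤n
  ... | o , ≡.refl = ≤-byDifference (fromℕ-nonNeg o) (sym (Mult.×-homo-+ 1# m o))

  fromℕ-* : ∀ m n → fromℕ (m ℕ.* n) ≈ fromℕ m * fromℕ n
  fromℕ-* = Mult.×1-homo-*

  -- If s were the supremum of ℕ then s - 1 would bound ℕ as well.
  fromℕ-unbounded : ∀ u → ¬ (∀ n → fromℕ n ≤ u)
  fromℕ-unbounded u bounded with supremum (λ x → ∃[ n ] x ≈ fromℕ n) (0# , 0 , refl)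
                                          (u , λ { x (n , x≈n) → ≤-trans (≤-reflexive x≈n) (bounded n) })
  ... | s , upper , least = <⇒≱ 0<1 (begin
    1#                ≈⟨ solve 1 (λ s → :1 := s :- (s :- :1)) refl s ⟩
    s - (s - 1#)      ≤⟨ +-monoˡ-≤ _ (least (s - 1#) λ { x (n , x≈n) → ≤-trans (≤-reflexive x≈n) (bound n) }) ⟩
    s - 1# - (s - 1#) ≈⟨ -‿inverseʳ _ ⟩
    0#                ∎)
    where
    bound : ∀ n → fromℕ n ≤ s - 1#
    bound n = begin
      fromℕ n               ≈⟨ solve 1 (λ n → n := :1 :+ n :- :1) refl (fromℕ n) ⟩
      fromℕ (suc n) - 1#    ≤⟨ +-monoˡ-≤ (- 1#) (upper _ (suc n , refl)) ⟩
      s - 1#                ∎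

-- Convexity of powers and of the exponential partial sums

module ExponentialSeries (R : RealNumbers) where

  open RealNumbers R hiding (zero)
  open RealAnalysis R
  open RingSolver R
  open OrderedField R
  open ≤-Reasoning

  ^-nonNeg : ∀ {x} → 0# ≤ x → ∀ n → 0# ≤ x ^ n
  ^-nonNeg 0≤x zero    = 0≤1
  ^-nonNeg 0≤x (suc n) = *-nonNeg 0≤x (^-nonNeg 0≤x n)

  -- Convexity of x ↦ x^(n+1) on [0,∞), proved without calculus: `a` times the tangent inequality
  -- for one exponent exceeds the next tangent by a multiple of (a - b)².
  ^-tangent : ∀ {a b} → 0# ≤ a → 0# ≤ b → ∀ n →
              b ^ suc n + fromℕ (suc n) * b ^ n * (a - b) ≤ a ^ suc n
  ^-tangent {a} {b} 0≤a 0≤b zero = ≤-reflexive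
    (solve 2 (λ a b → b :* :1 :+ (:1 :+ :0) :* :1 :* (a :- b) := a :* :1) refl a b)
  ^-tangent {a} {b} 0≤a 0≤b (suc n) = begin
    b * b ^ suc n + fromℕ (2 ℕ.+ n) * b ^ suc n * (a - b)
      ≤⟨ ≤-byDifference (*-nonNeg (*-nonNeg (fromℕ-nonNeg (suc n)) (^-nonNeg 0≤b n)) (square-nonNeg (a - b)))
           (solve 4 (λ a b p m → b :* (b :* p) :+ (:1 :+ m) :* (b :* p) :* (a :- b) :+ m :* p :* ((a :- b) :* (a :- b))
                                  := a :* (b :* p :+ m :* p :* (a :- b))) refl a b (b ^ n) (fromℕ (suc n))) ⟩
    a * (b ^ suc n + fromℕ (suc n) * b ^ n * (a - b))
      ≤⟨ *-monoʳ-≤ 0≤a (^-tangent 0≤a 0≤b n) ⟩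
    a * a ^ suc n ∎

  bernoulli : ∀ {x} → x ≤ 1# → ∀ n → 1# - fromℕ n * x ≤ (1# - x) ^ n
  bernoulli {x} x≤1 zero = ≤-reflexive (solve 1 (λ x → :1 :- :0 :* x := :1) refl x)
  bernoulli {x} x≤1 (suc n) = begin
    1# - fromℕ (suc n) * x
      ≤⟨ ≤-byDifference (*-nonNeg (fromℕ-nonNeg n) (square-nonNeg x))
           (solve 2 (λ x n → :1 :- (:1 :+ n) :* x :+ n :* (x :* x) := (:1 :- x) :* (:1 :- n :* x)) refl x (fromℕ n)) ⟩
    (1# - x) * (1# - fromℕ n * x)
      ≤⟨ *-monoʳ-≤ (≤⇒0≤- x≤1) (bernoulli x≤1 n) ⟩
    (1# - x) * (1# - x) ^ n ∎

  expTerm : ℝ → ℕ → ℝ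
  expTerm x k = x ^ k / fromℕ (k !)

  -- The slope is the preceding term because x^k / k! is the derivative of x^(k+1) / (k+1)!.
  expTerm-tangent : ∀ {a b} → 0# ≤ a → 0# ≤ b → ∀ k →
                    expTerm b (suc k) + (a - b) * expTerm b k ≤ expTerm a (suc k)
  expTerm-tangent {a} {b} 0≤a 0≤b k = begin
    b ^ suc k * fromℕ (suc k !) ⁻¹ + (a - b) * (b ^ k * q)
      ≈⟨ +-cong (*-congˡ split) (*-congˡ (*-congˡ expand)) ⟩
    b ^ suc k * (r * q) + (a - b) * (b ^ k * (s * r * q))
      ≈⟨ solve 6 (λ a b p r q s → b :* p :* (r :* q) :+ (a :- b) :* (p :* (s :* r :* q))
                                  := (b :* p :+ s :* p :* (a :- b)) :* (r :* q)) refl a b (b ^ k) r q s ⟩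
    (b ^ suc k + s * b ^ k * (a - b)) * (r * q)
      ≤⟨ *-monoˡ-≤ (*-nonNeg (⁻¹-nonNeg 0<s) (⁻¹-nonNeg 0<k!)) (^-tangent 0≤a 0≤b k) ⟩
    a ^ suc k * (r * q)
      ≈⟨ *-congˡ split ⟨
    expTerm a (suc k) ∎
    where
    s = fromℕ (suc k)
    r = s ⁻¹
    q = fromℕ (k !) ⁻¹
    0<s : 0# < s
    0<s = fromℕ-pos {suc k} (ℕ.s≤s ℕ.z≤n)
    0<k! : 0# < fromℕ (k !)
    0<k! = fromℕ-pos (ℕ.1≤n! k)
    split : fromℕ (suc k !) ⁻¹ ≈ r * q
    split = trans (⁻¹-cong (fromℕ-* (suc k) (k !))) (⁻¹-distrib-* 0<s 0<k!)
    expand : q ≈ s * r * q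
    expand = sym (trans (*-congʳ (*-inverseʳ (0<⇒≉0 0<s))) (*-identityˡ q))

  sum-tangent : ∀ n c (f g h : Fin n → ℝ) → (∀ k → f k + c * g k ≤ h k) →
                sum f + c * sum g ≤ sum h
  sum-tangent zero    c f g h le = ≤-reflexive (solve 1 (λ c → :0 :+ c :* :0 := :0) refl c)
  sum-tangent (suc n) c f g h le = begin
    (f₀ + fₛ) + c * (g₀ + gₛ)
      ≈⟨ solve 5 (λ c f₀ fₛ g₀ gₛ → (f₀ :+ fₛ) :+ c :* (g₀ :+ gₛ) := (f₀ :+ c :* g₀) :+ (fₛ :+ c :* gₛ)) refl c f₀ fₛ g₀ gₛ ⟩
    (f₀ + c * g₀) + (fₛ + c * gₛ)
      ≤⟨ +-mono-≤ (le Fin.zero) (sum-tangent n c (λ k → f (Fin.suc k)) (λ k → g (Fin.suc k)) (λ k → h (Fin.suc k)) (λ k → le (Fin.suc k))) ⟩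
    sum h ∎
    where
    f₀ = f Fin.zero
    g₀ = g Fin.zero
    fₛ = sum (λ k → f (Fin.suc k))
    gₛ = sum (λ k → g (Fin.suc k))

  -- Differentiation shortens a partial sum by one term, hence `suc n` for the values and `n` for
  -- the slope. The constant terms agree on both sides and are split off before the tangents are
  -- added up.
  expPartialSum-tangent : ∀ {a b} → 0# ≤ a → 0# ≤ b → ∀ n →
    expPartialSum b (suc n) + (a - b) * expPartialSum b n ≤ expPartialSum a (suc n)
  expPartialSum-tangent {a} {b} 0≤a 0≤b n = begin
    (t + sₛ) + (a - b) * expPartialSum b n   ≈⟨ +-assoc _ _ _ ⟩
    t + (sₛ + (a - b) * expPartialSum b n)
      ≤⟨ +-mono-≤ ≤-refl (sum-tangent n (a - b) (λ k → expTerm b (suc (toℕ k))) (λ k → expTerm b (toℕ k))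
                                      (λ k → expTerm a (suc (toℕ k))) (λ k → expTerm-tangent 0≤a 0≤b (toℕ k))) ⟩
    expPartialSum a (suc n) ∎
    where
    t = expTerm b 0
    sₛ = sum {n} (λ k → expTerm b (suc (toℕ k)))

  sum-zero : ∀ n (f : Fin n → ℝ) → (∀ k → f k ≈ 0#) → sum f ≈ 0#
  sum-zero zero    f f≈0 = refl
  sum-zero (suc n) f f≈0 = trans (+-cong (f≈0 Fin.zero) (sum-zero n (λ k → f (Fin.suc k)) (λ k → f≈0 (Fin.suc k)))) (+-identityˡ 0#)

  expPartialSum-0 : ∀ n → expPartialSum 0# (suc n) ≈ 1#
  expPartialSum-0 n = begin-equality
    1# * fromℕ 1 ⁻¹ + sum {n} (λ k → expTerm 0# (suc (toℕ k)))
      ≈⟨ +-congˡ (sum-zero n _ λ k → trans (*-congʳ (zeroˡ _)) (zeroˡ _)) ⟩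
    1# * fromℕ 1 ⁻¹ + 0#     ≈⟨ +-identityʳ _ ⟩
    1# * fromℕ 1 ⁻¹          ≈⟨ *-congʳ (+-identityʳ 1#) ⟨
    fromℕ 1 * fromℕ 1 ⁻¹     ≈⟨ *-inverseʳ (0<⇒≉0 (fromℕ-pos ℕ.≤-refl)) ⟩
    1#                       ∎

  -- Passage to the limit: inequalities for exp

  module Exponential {exp : ℝ → ℝ} (exp-def : IsExp exp) where

    module _ (n : ℕ) {x ε : ℝ} (close : ∣ expPartialSum x n - exp x ∣< ε) where

      upper : expPartialSum x n ≤ exp x + ε
      upper = 0≤-⇒≤ (≤-trans (≤⇒0≤- (<⇒≤ (proj₂ close)))
        (≤-reflexive (solve 3 (λ s e d → d :- (s :- e) := e :+ d :- s) refl (expPartialSum x n) (exp x) ε)))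

      lower : exp x ≤ expPartialSum x n + ε
      lower = 0≤-⇒≤ (≤-trans (≤⇒0≤- (<⇒≤ (proj₁ close)))
        (≤-reflexive (solve 3 (λ s e d → (s :- e) :- :- d := s :+ d :- e) refl (expPartialSum x n) (exp x) ε)))

    exp-tangent-upTo : ∀ {a b} → 0# ≤ a → 0# ≤ b → ∀ {ε} → 0# < ε →
                       exp b + (a - b) * exp b ≤ exp a + ((1# + 1#) + (a + b)) * ε
    exp-tangent-upTo {a} {b} 0≤a 0≤b {ε} 0<ε
      with exp-def a ε 0<ε | exp-def b ε 0<ε
    ... | M , M-close | N , N-close = begin
      e + (a - b) * e
        ≤⟨ +-mono-≤ (lower (suc n) bₛ)
             -- The sign of `a - b` is unknown, so the error in the slope is charged to `a` and to
             -- `b` separately, at a total cost of (a + b) ε.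
             (≤-byDifference {d = a * ((s + ε) - e) + b * ((e + ε) - s)}
               (+-nonNeg (*-nonNeg 0≤a (≤⇒0≤- (lower n b₀))) (*-nonNeg 0≤b (≤⇒0≤- (upper n b₀)))) refl) ⟩
      (s′ + ε) + ((a - b) * e + (a * ((s + ε) - e) + b * ((e + ε) - s)))
        ≈⟨ solve 6 (λ a b e s s′ d → (s′ :+ d) :+ ((a :- b) :* e :+ (a :* ((s :+ d) :- e) :+ b :* ((e :+ d) :- s)))
                                   := (s′ :+ (a :- b) :* s) :+ (:1 :+ (a :+ b)) :* d) refl a b e s s′ ε ⟩
      (s′ + (a - b) * s) + (1# + (a + b)) * ε
        ≤⟨ +-monoˡ-≤ _ (≤-trans (expPartialSum-tangent 0≤a 0≤b n) (upper (suc n) aₛ)) ⟩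
      (exp a + ε) + (1# + (a + b)) * ε
        ≈⟨ solve 4 (λ e a b d → (e :+ d) :+ (:1 :+ (a :+ b)) :* d := e :+ ((:1 :+ :1) :+ (a :+ b)) :* d) refl (exp a) a b ε ⟩
      exp a + ((1# + 1#) + (a + b)) * ε ∎
      where
      n = M ℕ.⊔ N
      e = exp b
      s = expPartialSum b n
      s′ = expPartialSum b (suc n)
      b₀ = N-close n (ℕ.m≤n⊔m M N)
      bₛ = N-close (suc n) (ℕ.m≤n⇒m≤1+n (ℕ.m≤n⊔m M N))
      aₛ = M-close (suc n) (ℕ.m≤n⇒m≤1+n (ℕ.m≤m⊔n M N))

    ≤-byApproximation : ∀ {x y c} → 0# < c → (∀ {ε} → 0# < ε → x ≤ y + c * ε) → x ≤ y
    ≤-byApproximation {x} {y} {c} 0<c approx = ≮⇒≥ λ y<x →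
      let d    = x - y
          half = (1# + 1#) * c
          0<2c = *-pos (+-pos-nonNeg 0<1 0≤1) 0<c
          0<d  : 0# < d
          0<d  = ≤⇒0≤- (<⇒≤ y<x) , λ 0≈d → proj₂ y<x (begin-equality
            y        ≈⟨ +-identityʳ y ⟨
            y + 0#   ≈⟨ +-congˡ 0≈d ⟩
            y + d    ≈⟨ solve 2 (λ x y → y :+ (x :- y) := x) refl x y ⟩
            x        ∎)
          -- This makes `c * ε` half of `d`, so the approximation reads d ≤ d / 2; it is used
          -- doubled, to avoid fractions.
          ε    = d / half
      in <⇒≱ 0<d (begin
        d                            ≈⟨ solve 2 (λ x y → x :- y := (:1 :+ :1) :* (x :- y) :- (x :- y)) refl x y ⟩
        (1# + 1#) * (x - y) - d      ≤⟨ +-monoˡ-≤ (- d) (*-monoʳ-≤ (+-nonNeg 0≤1 0≤1) (+-monoˡ-≤ (- y) (approx (*-pos 0<d (⁻¹-pos 0<2c))))) ⟩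
        (1# + 1#) * (y + c * ε - y) - d  ≈⟨ solve 4 (λ y c e d → (:1 :+ :1) :* (y :+ c :* e :- y) :- d := e :* ((:1 :+ :1) :* c) :- d) refl y c ε d ⟩
        d / half * half - d          ≈⟨ +-congʳ (/-*-cancel d (0<⇒≉0 0<2c)) ⟩
        d - d                        ≈⟨ -‿inverseʳ d ⟩
        0#                           ∎)

    exp-tangent : ∀ {a b} → 0# ≤ a → 0# ≤ b → (1# + (a - b)) * exp b ≤ exp a
    exp-tangent {a} {b} 0≤a 0≤b = ≤-trans
      (≤-reflexive (solve 3 (λ a b e → (:1 :+ (a :- b)) :* e := e :+ (a :- b) :* e) refl a b (exp b)))
      (≤-byApproximation (+-pos-nonNeg (+-pos-nonNeg 0<1 0≤1) (+-nonNeg 0≤a 0≤b)) (exp-tangent-upTo 0≤a 0≤b))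

    exp-0≤1 : exp 0# ≤ 1#
    exp-0≤1 = ≤-byApproximation 0<1 λ {ε} 0<ε → let (N , close) = exp-def 0# ε 0<ε in begin
      exp 0#                           ≤⟨ lower (suc N) (close (suc N) (ℕ.n≤1+n N)) ⟩
      expPartialSum 0# (suc N) + ε     ≈⟨ +-cong (expPartialSum-0 N) (sym (*-identityˡ ε)) ⟩
      1# + 1# * ε                      ∎

    1≤exp-0 : 1# ≤ exp 0#
    1≤exp-0 = ≤-byApproximation 0<1 λ {ε} 0<ε → let (N , close) = exp-def 0# ε 0<ε in begin
      1#                               ≈⟨ expPartialSum-0 N ⟨
      expPartialSum 0# (suc N)         ≤⟨ upper (suc N) (close (suc N) (ℕ.n≤1+n N)) ⟩
      exp 0# + ε                       ≈⟨ +-congˡ (*-identityˡ ε) ⟨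
      exp 0# + 1# * ε                  ∎

    -- `exp` comes as a bare function that is not assumed to respect `≈`. Between equal points the
    -- increment in the tangent inequality vanishes, and the two directions together give equality.
    exp-cong : ∀ {a b} → 0# ≤ a → a ≈ b → exp a ≈ exp b
    exp-cong {a} {b} 0≤a a≈b = ≤-antisym (below 0≤b 0≤a (sym a≈b)) (below 0≤a 0≤b a≈b)
      where
      0≤b = ≤-trans 0≤a (≤-reflexive a≈b)
      below : ∀ {a b} → 0# ≤ a → 0# ≤ b → a ≈ b → exp b ≤ exp a
      below {a} {b} 0≤a 0≤b a≈b = begin
        exp b                   ≈⟨ *-identityˡ _ ⟨
        1# * exp b              ≈⟨ *-congʳ (solve 1 (λ b → :1 := :1 :+ (b :- b)) refl b) ⟩
        (1# + (b - b)) * exp b  ≈⟨ *-congʳ (+-congˡ (+-congʳ a≈b)) ⟨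
        (1# + (a - b)) * exp b  ≤⟨ exp-tangent 0≤a 0≤b ⟩
        exp a                   ∎

    0<exp : ∀ {a} → 0# ≤ a → 0# < exp a
    0<exp {a} 0≤a = begin-strict
      0#                        <⟨ 0<1 ⟩
      1#                        ≤⟨ 1≤exp-0 ⟩
      exp 0#                    ≈⟨ *-identityˡ _ ⟨
      1# * exp 0#               ≤⟨ *-monoˡ-≤ (≤-trans 0≤1 1≤exp-0) (≤-byDifference 0≤a (solve 1 (λ a → :1 :+ a := :1 :+ (a :- :0)) refl a)) ⟩
      (1# + (a - 0#)) * exp 0#  ≤⟨ exp-tangent 0≤a ≤-refl ⟩
      exp a                     ∎

    module _ {b ε : ℝ} (0≤b : 0# ≤ b) (0≤ε : 0# ≤ ε) (ε≤1 : ε ≤ 1#) where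

      private
        ε²≤1 : ε * ε ≤ 1#
        ε²≤1 = ≤-trans (*-mono-≤ 0≤ε 0≤1 ε≤1 ε≤1) (≤-reflexive (*-identityˡ 1#))

        0≤kε : ∀ k → 0# ≤ fromℕ k * ε
        0≤kε k = *-nonNeg (fromℕ-nonNeg k) 0≤ε

      -- A step of length ε multiplies exp by at least 1 + ε on the left and
      -- by at most (1 − ε)⁻¹ on the right.
      exp-superadditive-steps : ∀ k →
        (1# - ε * ε) ^ k * (exp (fromℕ k * ε) * exp b) ≤ exp (fromℕ k * ε + b)
      exp-superadditive-steps zero = begin
        1# * (exp (0# * ε) * exp b)   ≈⟨ *-identityˡ _ ⟩
        exp (0# * ε) * exp b          ≈⟨ *-congʳ (exp-cong (0≤kε 0) (zeroˡ ε)) ⟩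
        exp 0# * exp b                ≤⟨ *-monoˡ-≤ (<⇒≤ (0<exp 0≤b)) exp-0≤1 ⟩
        1# * exp b                    ≈⟨ *-identityˡ _ ⟩
        exp b                         ≈⟨ exp-cong 0≤b (solve 2 (λ b e → b := :0 :* e :+ b) refl b ε) ⟩
        exp (0# * ε + b)              ∎
      exp-superadditive-steps (suc k) = begin
        (1# - ε * ε) * (1# - ε * ε) ^ k * (exp (m * ε) * exp b)
          ≈⟨ solve 4 (λ e p q r → (:1 :- e :* e) :* p :* (q :* r) := p :* (((:1 :- e) :* q) :* ((:1 :+ e) :* r)))
                     refl ε ((1# - ε * ε) ^ k) (exp (m * ε)) (exp b) ⟩
        (1# - ε * ε) ^ k * (((1# - ε) * exp (m * ε)) * ((1# + ε) * exp b))
          ≤⟨ *-monoʳ-≤ (^-nonNeg (≤⇒0≤- ε²≤1) k) (*-monoˡ-≤ (*-nonNeg (+-nonNeg 0≤1 0≤ε) (<⇒≤ (0<exp 0≤b)))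
               (≤-trans (*-monoˡ-≤ (<⇒≤ (0<exp (0≤kε (suc k)))) (≤-reflexive
                    (solve 2 (λ e k → :1 :- e := :1 :+ (k :* e :- (:1 :+ k) :* e)) refl ε (fromℕ k))))
                 (exp-tangent (0≤kε k) (0≤kε (suc k))))) ⟩
        (1# - ε * ε) ^ k * (exp (fromℕ k * ε) * ((1# + ε) * exp b))
          ≈⟨ solve 4 (λ e p q r → p :* (q :* ((:1 :+ e) :* r)) := (:1 :+ e) :* (p :* (q :* r)))
                     refl ε ((1# - ε * ε) ^ k) (exp (fromℕ k * ε)) (exp b) ⟩
        (1# + ε) * ((1# - ε * ε) ^ k * (exp (fromℕ k * ε) * exp b))
          ≤⟨ *-monoʳ-≤ (+-nonNeg 0≤1 0≤ε) (exp-superadditive-steps k) ⟩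
        (1# + ε) * exp (fromℕ k * ε + b)
          ≈⟨ *-congʳ (solve 3 (λ e k b → :1 :+ e := :1 :+ ((:1 :+ k) :* e :+ b :- (k :* e :+ b))) refl ε (fromℕ k) b) ⟩
        (1# + (m * ε + b - (fromℕ k * ε + b))) * exp (fromℕ k * ε + b)
          ≤⟨ exp-tangent (+-nonNeg (0≤kε (suc k)) 0≤b) (+-nonNeg (0≤kε k) 0≤b) ⟩
        exp (m * ε + b) ∎
        where m = fromℕ (suc k)

    -- With n steps of length ε = a / n the loss is a factor (1 - ε²)^n, at least 1 - n ε² = 1 - a ε
    -- by Bernoulli. A shortfall d > 0 would thus give n d ≤ a² e^a e^b = C for every n ≥ a with n ≥
    -- 1. Adding `a` to C / d also covers n ≤ a, where ε ≤ 1 could fail, and the resulting bound on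
    -- all of ℕ is absurd.
    exp-superadditive : ∀ {a b} → 0# ≤ a → 0# ≤ b → exp a * exp b ≤ exp (a + b)
    exp-superadditive {a} {b} 0≤a 0≤b = ≮⇒≥ λ lt →
      let d    = exp a * exp b - exp (a + b)
          0<d  : 0# < d
          0<d  = ≤⇒0≤- (<⇒≤ lt) , λ 0≈d → proj₂ lt (begin-equality
            exp (a + b)          ≈⟨ +-identityʳ _ ⟨
            exp (a + b) + 0#     ≈⟨ +-congˡ 0≈d ⟩
            exp (a + b) + d      ≈⟨ solve 2 (λ x y → y :+ (x :- y) := x) refl (exp a * exp b) (exp (a + b)) ⟩
            exp a * exp b        ∎)
          C    = a * a * (exp a * exp b)
          0≤C  : 0# ≤ C
          0≤C  = *-nonNeg (square-nonNeg a) (*-nonNeg (<⇒≤ (0<exp 0≤a)) (<⇒≤ (0<exp 0≤b)))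
          0≤C/d : 0# ≤ C / d
          0≤C/d = *-nonNeg 0≤C (⁻¹-nonNeg 0<d)
      in fromℕ-unbounded (a + C / d) λ
        { zero → +-nonNeg 0≤a 0≤C/d
        ; n@(suc _) → bound n (ℕ.s≤s ℕ.z≤n) 0<d 0≤C/d (total (fromℕ n) a) }
      where
      bound : ∀ n → 1 ℕ.≤ n →
              let d = exp a * exp b - exp (a + b) ; C = a * a * (exp a * exp b) in
              0# < d → 0# ≤ C / d → fromℕ n ≤ a ⊎ a ≤ fromℕ n → fromℕ n ≤ a + C / d
      bound n 1≤n 0<d 0≤C/d (inj₁ n≤a) = ≤-trans n≤a (≤-byDifference 0≤C/d refl)
      bound n 1≤n 0<d 0≤C/d (inj₂ a≤n) = ≤-trans n≤C/d (≤-byDifference 0≤a (+-comm _ _))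
        where
        N = fromℕ n
        0<N = fromℕ-pos 1≤n
        P = exp a * exp b
        d = P - exp (a + b)
        C = a * a * P
        ε = a / N
        0≤ε : 0# ≤ ε
        0≤ε = *-nonNeg 0≤a (⁻¹-nonNeg 0<N)
        Nε≈a : N * ε ≈ a
        Nε≈a = trans (*-comm N ε) (/-*-cancel a (0<⇒≉0 0<N))
        ε≤1 : ε ≤ 1#
        ε≤1 = *-cancelˡ-≤ 0<N (≤-trans (≤-reflexive Nε≈a) (≤-trans a≤n (≤-reflexive (sym (*-identityʳ N)))))
        0≤Nε : 0# ≤ N * ε
        0≤Nε = *-nonNeg (<⇒≤ 0<N) 0≤ε
        key : (1# - a * ε) * P ≤ exp (a + b)
        key = begin
          (1# - a * ε) * P                           ≈⟨ *-congʳ (+-congˡ (-‿cong (trans (*-congʳ (sym Nε≈a)) (*-assoc N ε ε)))) ⟩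
          (1# - N * (ε * ε)) * P
            ≤⟨ *-monoˡ-≤ (*-nonNeg (<⇒≤ (0<exp 0≤a)) (<⇒≤ (0<exp 0≤b)))
                 (bernoulli (≤-trans (*-mono-≤ 0≤ε 0≤1 ε≤1 ε≤1) (≤-reflexive (*-identityˡ 1#))) n) ⟩
          (1# - ε * ε) ^ n * P                        ≈⟨ *-congˡ (*-congʳ (exp-cong 0≤a (sym Nε≈a))) ⟩
          (1# - ε * ε) ^ n * (exp (N * ε) * exp b)    ≤⟨ exp-superadditive-steps 0≤b 0≤ε ε≤1 n ⟩
          exp (N * ε + b)                             ≈⟨ exp-cong (+-nonNeg 0≤Nε 0≤b) (+-congʳ Nε≈a) ⟩
          exp (a + b)                                 ∎
        n≤C/d : N ≤ C / d
        n≤C/d = *-cancelˡ-≤ 0<d (begin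
          d * N              ≤⟨ *-monoˡ-≤ (<⇒≤ 0<N) (0≤-⇒≤ (≤-trans (≤⇒0≤- key)
                                  (≤-reflexive (solve 4 (λ a e p x → x :- (:1 :- a :* e) :* p := a :* e :* p :- (p :- x)) refl a ε P (exp (a + b)))))) ⟩
          a * ε * P * N      ≈⟨ solve 4 (λ a e p n → a :* e :* p :* n := a :* (n :* e) :* p) refl a ε P N ⟩
          a * (N * ε) * P    ≈⟨ *-congʳ (*-congˡ Nε≈a) ⟩
          C                  ≈⟨ /-*-cancel C (0<⇒≉0 0<d) ⟨
          C / d * d          ≈⟨ *-comm _ _ ⟩
          d * (C / d)        ∎)

-- Finite sums, products and indicators

module FiniteSums (R : RealNumbers) where

  open RealNumbers R hiding (zero)
  open RingSolver R
  open OrderedField R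
  open ≤-Reasoning

  private variable
    A B : Set
    n : ℕ

  ∑ : List A → (A → ℝ) → ℝ
  ∑ xs g = foldr (λ x s → g x + s) 0# xs

  ∑-mono-≤ : ∀ (xs : List A) {g h : A → ℝ} → (∀ x → g x ≤ h x) → ∑ xs g ≤ ∑ xs h
  ∑-mono-≤ []       le = ≤-refl
  ∑-mono-≤ (x ∷ xs) le = +-mono-≤ (le x) (∑-mono-≤ xs le)

  ∑-cong : ∀ (xs : List A) {g h : A → ℝ} → (∀ x → g x ≈ h x) → ∑ xs g ≈ ∑ xs h
  ∑-cong []       eq = refl
  ∑-cong (x ∷ xs) eq = +-cong (eq x) (∑-cong xs eq)

  ∑-nonNeg : ∀ (xs : List A) {g : A → ℝ} → (∀ x → 0# ≤ g x) → 0# ≤ ∑ xs g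
  ∑-nonNeg []       le = ≤-refl
  ∑-nonNeg (x ∷ xs) le = +-nonNeg (le x) (∑-nonNeg xs le)

  ∑-+ : ∀ (xs : List A) (g h : A → ℝ) → ∑ xs (λ x → g x + h x) ≈ ∑ xs g + ∑ xs h
  ∑-+ []       g h = sym (+-identityˡ 0#)
  ∑-+ (x ∷ xs) g h = trans (+-congˡ (∑-+ xs g h))
    (solve 4 (λ a b c d → (a :+ b) :+ (c :+ d) := (a :+ c) :+ (b :+ d)) refl (g x) (h x) (∑ xs g) (∑ xs h))

  ∑-*ˡ : ∀ (xs : List A) c (g : A → ℝ) → ∑ xs (λ x → c * g x) ≈ c * ∑ xs g
  ∑-*ˡ []       c g = sym (zeroʳ c)
  ∑-*ˡ (x ∷ xs) c g = trans (+-congˡ (∑-*ˡ xs c g)) (sym (distribˡ c _ _))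

  ∑-const : ∀ (xs : List A) c → ∑ xs (λ _ → c) ≈ fromℕ (length xs) * c
  ∑-const []       c = sym (zeroˡ c)
  ∑-const (x ∷ xs) c = trans (+-congˡ (∑-const xs c)) (solve 2 (λ m c → c :+ m :* c := (:1 :+ m) :* c) refl (fromℕ (length xs)) c)

  ∑-++ : ∀ (xs ys : List A) (g : A → ℝ) → ∑ (xs ++ ys) g ≈ ∑ xs g + ∑ ys g
  ∑-++ []       ys g = sym (+-identityˡ _)
  ∑-++ (x ∷ xs) ys g = trans (+-congˡ (∑-++ xs ys g)) (sym (+-assoc _ _ _))

  ∑-map : ∀ (f : A → B) (xs : List A) (g : B → ℝ) → ∑ (List.map f xs) g ≈ ∑ xs (λ x → g (f x))
  ∑-map f []       g = refl
  ∑-map f (x ∷ xs) g = +-congˡ (∑-map f xs g)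

  ∑-swap : ∀ (xs : List A) (ys : List B) (g : A → B → ℝ) →
           ∑ xs (λ x → ∑ ys (g x)) ≈ ∑ ys (λ y → ∑ xs (λ x → g x y))
  ∑-swap []       ys g = sym (trans (∑-const ys 0#) (zeroʳ _))
  ∑-swap (x ∷ xs) ys g = trans (+-congˡ (∑-swap xs ys g)) (sym (∑-+ ys (g x) _))

  ∑-cartesianProduct : ∀ (xs : List A) (ys : List B) (g : A × B → ℝ) →
                       ∑ (cartesianProduct xs ys) g ≈ ∑ xs (λ x → ∑ ys (λ y → g (x , y)))
  ∑-cartesianProduct []       ys g = refl
  ∑-cartesianProduct (x ∷ xs) ys g =
    trans (∑-++ (List.map (x ,_) ys) (cartesianProduct xs ys) g)
          (+-cong (∑-map (x ,_) ys g) (∑-cartesianProduct xs ys g))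

  ∏ : List A → (A → ℝ) → ℝ
  ∏ xs g = foldr (λ x p → g x * p) 1# xs

  ∏-nonNeg : ∀ (xs : List A) {g : A → ℝ} → (∀ x → 0# ≤ g x) → 0# ≤ ∏ xs g
  ∏-nonNeg []       le = 0≤1
  ∏-nonNeg (x ∷ xs) le = *-nonNeg (le x) (∏-nonNeg xs le)

  ∏-≤1 : ∀ (xs : List A) {g : A → ℝ} → (∀ x → 0# ≤ g x) → (∀ x → g x ≤ 1#) → ∏ xs g ≤ 1#
  ∏-≤1 []       0≤g g≤1 = ≤-refl
  ∏-≤1 (x ∷ xs) 0≤g g≤1 = ≤-trans (*-mono-≤ (0≤g x) 0≤1 (g≤1 x) (∏-≤1 xs 0≤g g≤1)) (≤-reflexive (*-identityˡ 1#))

  ∏-cong-≡ : ∀ (xs : List A) {g h : A → ℝ} → (∀ x → g x ≡ h x) → ∏ xs g ≡ ∏ xs h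
  ∏-cong-≡ []       eq = ≡.refl
  ∏-cong-≡ (x ∷ xs) eq = ≡.cong₂ _*_ (eq x) (∏-cong-≡ xs eq)

  ∏-zero : ∀ {xs : List A} {g : A → ℝ} {x} → x List∈.∈ xs → g x ≈ 0# → ∏ xs g ≈ 0#
  ∏-zero (here ≡.refl) gx≈0 = trans (*-congʳ gx≈0) (zeroˡ _)
  ∏-zero (there x∈xs)  gx≈0 = trans (*-congˡ (∏-zero x∈xs gx≈0)) (zeroʳ _)

  𝟙 : Bool → ℝ
  𝟙 true  = 1#
  𝟙 false = 0#

  𝟙-nonNeg : ∀ b → 0# ≤ 𝟙 b
  𝟙-nonNeg true  = 0≤1
  𝟙-nonNeg false = ≤-refl

  𝟙-≤1 : ∀ b → 𝟙 b ≤ 1#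
  𝟙-≤1 true  = ≤-refl
  𝟙-≤1 false = 0≤1

  𝟙-mono-≤ : ∀ {P Q : Set} (P? : Dec P) (Q? : Dec Q) → (P → Q) → 𝟙 (does P?) ≤ 𝟙 (does Q?)
  𝟙-mono-≤ (no _)  Q?      P⇒Q = 𝟙-nonNeg (does Q?)
  𝟙-mono-≤ (yes p) (yes _) P⇒Q = ≤-refl
  𝟙-mono-≤ (yes p) (no ¬q) P⇒Q with () ← ¬q (P⇒Q p)

  ≤𝟙 : ∀ {P : Set} (P? : Dec P) {x} → x ≤ 1# → (¬ P → x ≤ 0#) → x ≤ 𝟙 (does P?)
  ≤𝟙 (yes _) x≤1 x≤0 = x≤1
  ≤𝟙 (no ¬p) x≤1 x≤0 = x≤0 ¬p

  𝟙-product≤ : ∀ {P Q R : Set} (P? : Dec P) (Q? : Dec Q) (R? : Dec R) {e} → 0# ≤ e → (P → Q → R → 1# ≤ e) →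
               𝟙 (does P?) * (𝟙 (does Q?) * 𝟙 (does R?)) ≤ e
  𝟙-product≤ (no _)  Q?      R?      0≤e all = ≤-trans (≤-reflexive (zeroˡ _)) 0≤e
  𝟙-product≤ (yes _) (no _)  R?      0≤e all = ≤-trans (≤-reflexive (trans (*-congˡ (zeroˡ _)) (zeroʳ _))) 0≤e
  𝟙-product≤ (yes _) (yes _) (no _)  0≤e all = ≤-trans (≤-reflexive (trans (*-congˡ (zeroʳ _)) (zeroʳ _))) 0≤e
  𝟙-product≤ (yes p) (yes q) (yes r) 0≤e all = ≤-trans (≤-reflexive (solve 0 (:1 :* (:1 :* :1) := :1) refl)) (all p q r)

  ∑-filter : ∀ {P : Pred A 0ℓ} (P? : Decidable P) xs (g : A → ℝ) →
             ∑ (filter P? xs) g ≈ ∑ xs (λ x → 𝟙 (does (P? x)) * g x)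
  ∑-filter P? []       g = refl
  ∑-filter P? (x ∷ xs) g with does (P? x)
  ... | true  = +-cong (sym (*-identityˡ _)) (∑-filter P? xs g)
  ... | false = trans (∑-filter P? xs g) (trans (sym (+-identityˡ _)) (+-congʳ (sym (zeroˡ _))))

  ∑-tabulate : ∀ {n} (f : Fin n → A) (h : Fin n → B) (g : A → ℝ) (k : B → ℝ) →
               (∀ i → g (f i) ≈ k (h i)) → ∑ (List.tabulate f) g ≈ ∑ (List.tabulate h) k
  ∑-tabulate {n = zero}  f h g k eq = refl
  ∑-tabulate {n = suc n} f h g k eq =
    +-cong (eq Fin.zero) (∑-tabulate (λ i → f (Fin.suc i)) (λ i → h (Fin.suc i)) g k (λ i → eq (Fin.suc i)))

  ∑-lookup : ∀ (I : Subset n) → ∑ (allFin n) (λ u → 𝟙 (lookup I u)) ≈ fromℕ ∣ I ∣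
  ∑-lookup Vec.[]          = refl
  ∑-lookup (b Vec.∷ I) = trans
    (+-congˡ (trans (∑-tabulate Fin.suc (λ i → i) _ (λ u → 𝟙 (lookup I u)) (λ _ → refl)) (∑-lookup I)))
    (head b)
    where
    head : ∀ b → 𝟙 b + fromℕ ∣ I ∣ ≈ fromℕ ∣ b Vec.∷ I ∣
    head true  = refl
    head false = +-identityˡ _

  ≤∑-member : ∀ {xs : List A} {g : A → ℝ} {x} → (∀ y → 0# ≤ g y) → x List∈.∈ xs → g x ≤ ∑ xs g
  ≤∑-member {xs = x ∷ xs} 0≤g (here ≡.refl)  = ≤-byDifference (∑-nonNeg xs 0≤g) refl
  ≤∑-member {xs = y ∷ xs} 0≤g (there x∈xs)   = ≤-trans (≤∑-member 0≤g x∈xs) (≤-byDifference (0≤g y) (+-comm _ _))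

  ⊥∈subsets : ∀ n → ⊥ List∈.∈ subsets n
  ⊥∈subsets zero    = here ≡.refl
  ⊥∈subsets (suc n) = List∈.∈-++⁺ʳ (List.map (true Vec.∷_) (subsets n)) (List∈.∈-map⁺ (false Vec.∷_) (⊥∈subsets n))

  ∑-subsets-suc : ∀ (g : Subset (suc n) → ℝ) →
    ∑ (subsets (suc n)) g ≈ ∑ (subsets n) (λ I → g (true Vec.∷ I)) + ∑ (subsets n) (λ I → g (false Vec.∷ I))
  ∑-subsets-suc {n} g = trans (∑-++ (List.map (true Vec.∷_) (subsets n)) _ g)
                              (+-cong (∑-map (true Vec.∷_) (subsets n) g) (∑-map (false Vec.∷_) (subsets n) g))

  insert : Fin n → Subset n → Subset n
  insert u I = I [ u ]≔ true

  -- The pairs I, I ∪ {u} with u outside I partition the subsets, so a comparison on pairs is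
  -- enough. This is the substitute for conditioning on everything except the state of u.
  ∑-toggle-≤ : ∀ (u : Fin n) {g h : Subset n → ℝ} →
    (∀ I → lookup I u ≡ false → g I + g (insert u I) ≤ h I + h (insert u I)) →
    ∑ (subsets n) g ≤ ∑ (subsets n) h
  ∑-toggle-≤ {suc n} Fin.zero {g} {h} le = begin
    ∑ (subsets (suc n)) g                           ≈⟨ pairs g ⟩
    ∑ (subsets n) (λ I → g (false Vec.∷ I) + g (true Vec.∷ I))  ≤⟨ ∑-mono-≤ (subsets n) (λ I → le (false Vec.∷ I) ≡.refl) ⟩
    ∑ (subsets n) (λ I → h (false Vec.∷ I) + h (true Vec.∷ I))  ≈⟨ pairs h ⟨
    ∑ (subsets (suc n)) h                           ∎
    where
    pairs : ∀ g → ∑ (subsets (suc n)) g ≈ ∑ (subsets n) (λ I → g (false Vec.∷ I) + g (true Vec.∷ I))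
    pairs g = trans (∑-subsets-suc g) (trans (+-comm _ _) (sym (∑-+ (subsets n) _ _)))
  ∑-toggle-≤ {suc n} (Fin.suc u) {g} {h} le = begin
    ∑ (subsets (suc n)) g   ≈⟨ ∑-subsets-suc g ⟩
    _                       ≤⟨ +-mono-≤ (∑-toggle-≤ u (λ I → le (true Vec.∷ I))) (∑-toggle-≤ u (λ I → le (false Vec.∷ I))) ⟩
    _                       ≈⟨ ∑-subsets-suc h ⟨
    ∑ (subsets (suc n)) h   ∎

  ∑-toggle-≈ : ∀ (u : Fin n) {g h : Subset n → ℝ} →
    (∀ I → lookup I u ≡ false → g I + g (insert u I) ≈ h I + h (insert u I)) →
    ∑ (subsets n) g ≈ ∑ (subsets n) h
  ∑-toggle-≈ u eq = ≤-antisym (∑-toggle-≤ u (λ I u∉I → ≤-reflexive (eq I u∉I)))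
                              (∑-toggle-≤ u (λ I u∉I → ≤-reflexive (sym (eq I u∉I))))

-- Inserting an element into a subset

module Insertion (R : RealNumbers) where
  open RealNumbers R hiding (zero)
  open FiniteSums R

  private variable
    n : ℕ

  u∈insert : ∀ (u : Fin n) I → u ∈ insert u I
  u∈insert u I = Vec.[]≔-updates I u

  ∈-insert⁺ : ∀ {t} (u : Fin n) {I} → t ∈ I → t ∈ insert u I
  ∈-insert⁺ {t = t} u {I} t∈I with t Fin.≟ u
  ... | yes ≡.refl = u∈insert u I
  ... | no t≢u     = Vec.[]≔-minimal I t u t≢u t∈I

  ∈-insert⁻ : ∀ {t} (u : Fin n) {I} → t ∈ insert u I → t ≡ u ⊎ t ∈ I
  ∈-insert⁻ {t = t} u {I} t∈ with t Fin.≟ u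
  ... | yes t≡u = inj₁ t≡u
  ... | no t≢u  = inj₂ (Vec.lookup⇒[]= t I (≡.trans (≡.sym (Vec.lookup∘update′ t≢u I true)) (Vec.[]=⇒lookup t∈)))

  ∣insert∣ : ∀ (u : Fin n) I → lookup I u ≡ false → ∣ insert u I ∣ ≡ suc ∣ I ∣
  ∣insert∣ Fin.zero    (false Vec.∷ I) ≡.refl = ≡.refl
  ∣insert∣ (Fin.suc u) (true  Vec.∷ I) u∉I    = ≡.cong suc (∣insert∣ u I u∉I)
  ∣insert∣ (Fin.suc u) (false Vec.∷ I) u∉I    = ∣insert∣ u I u∉I

-- The hard-core model around a vertex

module LocalOccupancy (R : RealNumbers) (G : Graph) (fugacity : RealNumbers.ℝ R)
                      (0<fugacity : RealNumbers._<_ R (RealNumbers.0# R) fugacity) where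

  open RealNumbers R hiding (zero)
  open RingSolver R
  open OrderedField R
  open ExponentialSeries R using (^-nonNeg)
  open FiniteSums R
  open Insertion R
  open ≤-Reasoning
  open Graph G
  open HardCore R G

  0≤fugacity : 0# ≤ fugacity
  0≤fugacity = <⇒≤ 0<fugacity

  adjacent : Vertex → Vertex → Bool
  adjacent u v = does (u ~? v)

  adjacent-sym : ∀ u v → adjacent u v ≡ adjacent v u
  adjacent-sym u v = does-⇔ (mk⇔ ~-sym ~-sym) (u ~? v) (v ~? u)

  Free : Vertex → Subset order → Set
  Free u I = ∀ t → t ∈ I → ¬ u ~ t

  Uncovered : Vertex → Vertex → Subset order → Set
  Uncovered v u I = ∀ t → t ∈ I → ¬ v ~ t → ¬ u ~ t

  free? : ∀ u I → Dec (Free u I)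
  free? u I = Fin.all? λ t → (t ∈? I) →-dec ¬? (u ~? t)

  uncovered? : ∀ v u I → Dec (Uncovered v u I)
  uncovered? v u I = Fin.all? λ t → (t ∈? I) →-dec (¬? (v ~? t) →-dec ¬? (u ~? t))

  free : Vertex → Subset order → Bool
  free u I = does (free? u I)

  uncovered : Vertex → Vertex → Subset order → Bool
  uncovered v u I = does (uncovered? v u I)

  free-insert : ∀ u I → free u (insert u I) ≡ free u I
  free-insert u I = does-⇔ (mk⇔ (λ fr t t∈I → fr t (∈-insert⁺ u t∈I)) to) (free? u (insert u I)) (free? u I)
    where
    to : Free u I → Free u (insert u I)
    to fr t t∈ with ∈-insert⁻ u t∈
    ... | inj₁ ≡.refl = ~-irrefl ≡.refl
    ... | inj₂ t∈I    = fr t t∈I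

  -- Whether `s` is uncovered depends on I ∖ N(v) alone. Hence every penalty attached to `v` is
  -- constant on a pair that toggles a neighbour of `v`.
  uncovered-insert : ∀ v u s I → v ~ u → uncovered v s (insert u I) ≡ uncovered v s I
  uncovered-insert v u s I v~u =
    does-⇔ (mk⇔ (λ un t t∈I → un t (∈-insert⁺ u t∈I)) to) (uncovered? v s (insert u I)) (uncovered? v s I)
    where
    to : Uncovered v s I → Uncovered v s (insert u I)
    to un t t∈ v≁t with ∈-insert⁻ u t∈
    ... | inj₁ ≡.refl = ⊥-elim (v≁t v~u)
    ... | inj₂ t∈I    = un t t∈I v≁t

  -- Sets that are not independent get weight 0, so that sums run over all subsets and toggling a
  -- vertex never leaves their range.
  weight : Subset order → ℝ
  weight I = 𝟙 (does (independent? I)) * fugacity ^ ∣ I ∣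

  weight-nonNeg : ∀ I → 0# ≤ weight I
  weight-nonNeg I = *-nonNeg (𝟙-nonNeg (does (independent? I))) (^-nonNeg 0≤fugacity ∣ I ∣)

  independent-insert : ∀ u I → does (independent? (insert u I)) ≡ free u I ∧ does (independent? I)
  independent-insert u I = does-⇔ (mk⇔ from to) (independent? (insert u I)) (free? u I ×-dec independent? I)
    where
    from : Independent (insert u I) → Free u I × Independent I
    from ind = (λ t t∈I → ind u (u∈insert u I) t (∈-insert⁺ u t∈I))
             , (λ s s∈I t t∈I → ind s (∈-insert⁺ u s∈I) t (∈-insert⁺ u t∈I))
    to : Free u I × Independent I → Independent (insert u I)
    to (fr , ind) s s∈ t t∈ s~t with ∈-insert⁻ u s∈ | ∈-insert⁻ u t∈
    ... | inj₁ ≡.refl | inj₁ ≡.refl = ~-irrefl ≡.refl s~t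
    ... | inj₁ ≡.refl | inj₂ t∈I    = fr t t∈I s~t
    ... | inj₂ s∈I    | inj₁ ≡.refl = fr s s∈I (~-sym s~t)
    ... | inj₂ s∈I    | inj₂ t∈I    = ind s s∈I t t∈I s~t

  weight-insert : ∀ u I → lookup I u ≡ false → weight (insert u I) ≈ 𝟙 (free u I) * (fugacity * weight I)
  weight-insert u I u∉I rewrite independent-insert u I | ∣insert∣ u I u∉I with free u I
  ... | true  = solve 3 (λ l i p → i :* (l :* p) := :1 :* (l :* (i :* p))) refl fugacity (𝟙 (does (independent? I))) (fugacity ^ ∣ I ∣)
  ... | false = trans (zeroˡ _) (sym (zeroˡ _))

  -- Expectations without the normalising factor.
  E : (Subset order → ℝ) → ℝ
  E X = ∑ (subsets order) λ I → weight I * X I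

  Z₁ : ℝ
  Z₁ = E λ _ → 1#

  Σ-independent≈∑ : ∀ g → Σ-independent g ≈ ∑ (subsets order) (λ I → 𝟙 (does (independent? I)) * g I)
  Σ-independent≈∑ g = ∑-filter independent? (subsets order) g

  0<Z₁ : 0# < Z₁
  0<Z₁ = begin-strict
    0#             <⟨ 0<1 ⟩
    1#             ≈⟨ solve 0 (:1 := :1 :* :1 :* :1) refl ⟩
    1# * 1# * 1#   ≡⟨ ≡.cong (_* 1#) (≡.cong₂ (λ b k → 𝟙 b * fugacity ^ k) (dec-true (independent? ⊥) λ u u∈⊥ → ⊥-elim (∉⊥ u∈⊥)) (∣⊥∣≡0 order)) ⟨
    weight ⊥ * 1#  ≤⟨ ≤∑-member {g = λ I → weight I * 1#} (λ I → *-nonNeg (weight-nonNeg I) 0≤1) (⊥∈subsets order) ⟩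
    Z₁             ∎

  Z≈Z₁ : Z fugacity ≈ Z₁
  Z≈Z₁ = trans (Σ-independent≈∑ _) (∑-cong (subsets order) λ I → sym (*-identityʳ _))

  𝔼≈E/Z : ∀ X → 𝔼 fugacity X ≈ E X / Z₁
  𝔼≈E/Z X = begin-equality
    𝔼 fugacity X ≈⟨ Σ-independent≈∑ _ ⟩
    _            ≈⟨ ∑-cong (subsets order) (λ I → trans (*-congˡ (*-congʳ (*-congˡ (⁻¹-cong Z≈Z₁))))
                     (solve 4 (λ i p z x → i :* (p :* z :* x) := z :* (i :* p :* x)) refl (𝟙 (does (independent? I))) (fugacity ^ ∣ I ∣) (Z₁ ⁻¹) (X I))) ⟩
    _            ≈⟨ ∑-*ˡ (subsets order) (Z₁ ⁻¹) (λ I → weight I * X I) ⟩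
    Z₁ ⁻¹ * E X  ≈⟨ *-comm _ _ ⟩
    E X / Z₁     ∎

  E-mono-≤ : ∀ {X Y} → (∀ I → X I ≤ Y I) → E X ≤ E Y
  E-mono-≤ le = ∑-mono-≤ (subsets order) λ I → *-monoʳ-≤ (weight-nonNeg I) (le I)

  E-cong : ∀ {X Y} → (∀ I → X I ≈ Y I) → E X ≈ E Y
  E-cong eq = ∑-cong (subsets order) λ I → *-congˡ (eq I)

  E-nonNeg : ∀ {X} → (∀ I → 0# ≤ X I) → 0# ≤ E X
  E-nonNeg le = ∑-nonNeg (subsets order) λ I → *-nonNeg (weight-nonNeg I) (le I)

  E-+ : ∀ X Y → E (λ I → X I + Y I) ≈ E X + E Y
  E-+ X Y = trans (∑-cong (subsets order) λ I → distribˡ (weight I) (X I) (Y I)) (∑-+ (subsets order) _ _)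

  E-*ˡ : ∀ c X → E (λ I → c * X I) ≈ c * E X
  E-*ˡ c X = trans (∑-cong (subsets order) λ I → solve 3 (λ w c x → w :* (c :* x) := c :* (w :* x)) refl (weight I) c (X I))
                   (∑-*ˡ (subsets order) c _)

  E-∑ : ∀ {A : Set} (xs : List A) (X : A → Subset order → ℝ) → E (λ I → ∑ xs (λ x → X x I)) ≈ ∑ xs (λ x → E (X x))
  E-∑ xs X = trans (∑-cong (subsets order) λ I → sym (∑-*ˡ xs (weight I) _)) (∑-swap (subsets order) xs _)

  occupied : Vertex → ℝ
  occupied u = E λ I → 𝟙 (lookup I u)

  unblocked : Vertex → ℝ
  unblocked u = E λ I → 𝟙 (free u I)

  -- In a pair I, I ∪ {u} with u free the weights are in ratio 1 : λ, and both sides contribute λ (1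
  -- + λ) times the weight of I. If u is blocked, I ∪ {u} has weight 0 and both sides vanish.
  occupied-unblocked : ∀ u → (1# + fugacity) * occupied u ≈ fugacity * unblocked u
  occupied-unblocked u = begin-equality
    (1# + fugacity) * occupied u                                        ≈⟨ ∑-*ˡ (subsets order) _ _ ⟨
    ∑ (subsets order) (λ I → (1# + fugacity) * (weight I * 𝟙 (lookup I u)))  ≈⟨ ∑-toggle-≈ u toggle ⟩
    ∑ (subsets order) (λ I → fugacity * (weight I * 𝟙 (free u I)))      ≈⟨ ∑-*ˡ (subsets order) _ _ ⟩
    fugacity * unblocked u                                              ∎
    where
    toggle : ∀ I → lookup I u ≡ false →
      (1# + fugacity) * (weight I * 𝟙 (lookup I u)) + (1# + fugacity) * (weight (insert u I) * 𝟙 (lookup (insert u I) u))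
      ≈ fugacity * (weight I * 𝟙 (free u I)) + fugacity * (weight (insert u I) * 𝟙 (free u (insert u I)))
    toggle I u∉I rewrite u∉I | Vec.lookup∘update u I true | free-insert u I = trans
      (+-congˡ (*-congˡ (*-congʳ (weight-insert u I u∉I))))
      (trans (lemma (free u I)) (+-congˡ (*-congˡ (*-congʳ (sym (weight-insert u I u∉I))))))
      where
      lemma : ∀ b → (1# + fugacity) * (weight I * 0#) + (1# + fugacity) * (𝟙 b * (fugacity * weight I) * 1#)
                    ≈ fugacity * (weight I * 𝟙 b) + fugacity * (𝟙 b * (fugacity * weight I) * 𝟙 b)
      lemma true  = solve 2 (λ l w → (:1 :+ l) :* (w :* :0) :+ (:1 :+ l) :* (:1 :* (l :* w) :* :1)
                                     := l :* (w :* :1) :+ l :* (:1 :* (l :* w) :* :1)) refl fugacity (weight I)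
      lemma false = solve 2 (λ l w → (:1 :+ l) :* (w :* :0) :+ (:1 :+ l) :* (:0 :* (l :* w) :* :1)
                                     := l :* (w :* :0) :+ l :* (:0 :* (l :* w) :* :0)) refl fugacity (weight I)

  E-∣∣ : E (λ I → fromℕ ∣ I ∣) ≈ ∑ (allFin order) occupied
  E-∣∣ = trans (E-cong λ I → sym (∑-lookup I)) (E-∑ (allFin order) λ u I → 𝟙 (lookup I u))

  unblocked≤Z : ∀ u → unblocked u ≤ Z₁
  unblocked≤Z u = E-mono-≤ λ I → 𝟙-≤1 (free u I)

  -- An uncovered neighbour u of v is free unless a common neighbour of u and v is occupied.
  uncovered≤ : ∀ v u → E (λ I → 𝟙 (uncovered v u I))
               ≤ unblocked u + ∑ (allFin order) (λ t → 𝟙 (adjacent u t) * 𝟙 (adjacent v t) * occupied t)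
  uncovered≤ v u = begin
    E (λ I → 𝟙 (uncovered v u I))   ≤⟨ E-mono-≤ pointwise ⟩
    E (λ I → 𝟙 (free u I) + ∑ (allFin order) (λ t → 𝟙 (adjacent u t) * 𝟙 (adjacent v t) * 𝟙 (lookup I t)))
      ≈⟨ trans (E-+ _ _) (+-congˡ (trans (E-∑ (allFin order) _) (∑-cong (allFin order) λ t → E-*ˡ _ _))) ⟩
    unblocked u + ∑ (allFin order) (λ t → 𝟙 (adjacent u t) * 𝟙 (adjacent v t) * occupied t) ∎
    where
    common : Subset order → Vertex → ℝ
    common I t = 𝟙 (adjacent u t) * 𝟙 (adjacent v t) * 𝟙 (lookup I t)
    common-nonNeg : ∀ I t → 0# ≤ common I t
    common-nonNeg I t = *-nonNeg (*-nonNeg (𝟙-nonNeg (adjacent u t)) (𝟙-nonNeg (adjacent v t))) (𝟙-nonNeg (lookup I t))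
    pointwise : ∀ I → 𝟙 (uncovered v u I) ≤ 𝟙 (free u I) + ∑ (allFin order) (common I)
    pointwise I with Fin.any? (λ t → (u ~? t) ×-dec ((v ~? t) ×-dec (t ∈? I)))
    ... | no ¬common = ≤-trans
      (𝟙-mono-≤ (uncovered? v u I) (free? u I) λ un t t∈I u~t → un t t∈I (λ v~t → ¬common (t , u~t , v~t , t∈I)) u~t)
      (≤-byDifference (∑-nonNeg (allFin order) (common-nonNeg I)) refl)
    ... | yes (t , u~t , v~t , t∈I) = begin
      𝟙 (uncovered v u I)               ≤⟨ 𝟙-≤1 (uncovered v u I) ⟩
      1#                                ≈⟨ solve 0 (:1 := :1 :* :1 :* :1) refl ⟩
      1# * 1# * 1#                      ≡⟨ ≡.cong₂ _*_ (≡.cong₂ _*_ (≡.cong 𝟙 (dec-true (u ~? t) u~t)) (≡.cong 𝟙 (dec-true (v ~? t) v~t)))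
                                                     (≡.cong 𝟙 (Vec.[]=⇒lookup t∈I)) ⟨
      common I t                        ≤⟨ ≤∑-member (common-nonNeg I) (List∈.∈-allFin t) ⟩
      ∑ (allFin order) (common I)       ≤⟨ ≤-byDifference (𝟙-nonNeg (free u I)) (+-comm _ _) ⟩
      𝟙 (free u I) + ∑ (allFin order) (common I) ∎

  fromℕ-degree : ∀ u → fromℕ (degree u) ≈ ∑ (allFin order) (λ v → 𝟙 (adjacent u v))
  fromℕ-degree u = trans (sym (∑-lookup (neighbourhood u)))
    (∑-cong (allFin order) λ v → reflexive (≡.cong 𝟙 (Vec.lookup∘tabulate (λ w → does (u ~? w)) v)))

  ∈-neighbourhood : ∀ {u v} → u ~ v → v ∈ neighbourhood u
  ∈-neighbourhood {u} {v} u~v = Vec.lookup⇒[]= v (neighbourhood u)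
    (≡.trans (Vec.lookup∘tabulate (λ w → does (u ~? w)) v) (dec-true (u ~? v) u~v))

  triangles : Vertex → ℝ
  triangles v = ∑ (allFin order) λ u → ∑ (allFin order) λ t → 𝟙 (adjacent v u) * (𝟙 (adjacent u t) * 𝟙 (adjacent v t))

  -- `triangles` counts ordered pairs of adjacent neighbours of `v`, whereas `inducedEdges` lists
  -- each edge in increasing order only; this is the source of the 2 in 2 m L².
  triangles≤ : ∀ v → triangles v ≤ (1# + 1#) * fromℕ (length (inducedEdges (neighbourhood v)))
  triangles≤ v = begin
    triangles v   ≤⟨ ∑-mono-≤ (allFin order) (λ u → ∑-mono-≤ (allFin order) (pointwise u)) ⟩
    ∑ (allFin order) (λ u → ∑ (allFin order) (λ t → edge u t + edge t u))
      ≈⟨ trans (∑-cong (allFin order) λ u → ∑-+ (allFin order) _ _) (∑-+ (allFin order) _ _) ⟩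
    edges + ∑ (allFin order) (λ u → ∑ (allFin order) (λ t → edge t u))
      ≈⟨ +-congˡ (∑-swap (allFin order) (allFin order) (λ u t → edge t u)) ⟩
    edges + edges
      ≈⟨ solve 1 (λ e → e :+ e := (:1 :+ :1) :* e) refl edges ⟩
    (1# + 1#) * edges
      ≈⟨ *-congˡ count ⟨
    (1# + 1#) * fromℕ (length (inducedEdges S)) ∎
    where
    S = neighbourhood v
    edge? : ∀ ((u , t) : Vertex × Vertex) → Dec (u Fin.< t × u ∈ S × t ∈ S × u ~ t)
    edge? (u , t) = (u Fin.<? t) ×-dec (u ∈? S) ×-dec (t ∈? S) ×-dec (u ~? t)
    edge : Vertex → Vertex → ℝ
    edge u t = 𝟙 (does (edge? (u , t)))
    edges = ∑ (allFin order) (λ u → ∑ (allFin order) (edge u))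
    count : fromℕ (length (inducedEdges S)) ≈ edges
    count = begin-equality
      fromℕ (length (inducedEdges S))        ≈⟨ *-identityʳ _ ⟨
      fromℕ (length (inducedEdges S)) * 1#   ≈⟨ ∑-const (inducedEdges S) 1# ⟨
      ∑ (inducedEdges S) (λ _ → 1#)          ≈⟨ ∑-filter edge? (cartesianProduct (allFin order) (allFin order)) (λ _ → 1#) ⟩
      _                                      ≈⟨ ∑-cartesianProduct (allFin order) (allFin order) _ ⟩
      _                                      ≈⟨ ∑-cong (allFin order) (λ u → ∑-cong (allFin order) λ t → *-identityʳ _) ⟩
      edges                                  ∎
    edge-true : ∀ {u t} → v ~ u → u ~ t → v ~ t → u Fin.< t → 1# ≤ edge u t
    edge-true {u} {t} v~u u~t v~t u<t = ≤-reflexive (reflexive (≡.cong 𝟙 (≡.sym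
      (dec-true (edge? (u , t)) (u<t , ∈-neighbourhood v~u , ∈-neighbourhood v~t , u~t)))))
    edge-nonNeg : ∀ u t → 0# ≤ edge u t
    edge-nonNeg u t = 𝟙-nonNeg (does (edge? (u , t)))
    pointwise : ∀ u t → 𝟙 (adjacent v u) * (𝟙 (adjacent u t) * 𝟙 (adjacent v t)) ≤ edge u t + edge t u
    pointwise u t = 𝟙-product≤ (v ~? u) (u ~? t) (v ~? t) (+-nonNeg (edge-nonNeg u t) (edge-nonNeg t u)) λ v~u u~t v~t →
      case-<-cmp u t u~t (λ u<t → ≤-trans (edge-true v~u u~t v~t u<t) (≤-byDifference (edge-nonNeg t u) refl))
                         (λ t<u → ≤-trans (edge-true v~t (~-sym u~t) v~u t<u) (≤-byDifference (edge-nonNeg u t) (+-comm _ _)))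
      where
      case-<-cmp : ∀ {X : Set} u t → u ~ t → (u Fin.< t → X) → (t Fin.< u → X) → X
      case-<-cmp u t u~t below above with Fin.<-cmp u t
      ... | tri< u<t _ _    = below u<t
      ... | tri≈ _ ≡.refl _ = ⊥-elim (~-irrefl ≡.refl u~t)
      ... | tri> _ _ t<u    = above t<u

  -- Probability of an empty neighbourhood, one neighbour at a time

  retention : ℝ
  retention = (1# + fugacity) ⁻¹

  0<1+fugacity : 0# < 1# + fugacity
  0<1+fugacity = +-pos-nonNeg 0<1 0≤fugacity

  -- Over all u the product of these factors is (1 + λ)^(-Y), and that of the `vacant` factors is
  -- the indicator of N(v) ∩ I = ∅. The product form allows the factors to be exchanged singly.
  penalty : Vertex → Vertex → Subset order → ℝ
  penalty v u I = if adjacent v u ∧ uncovered v u I then retention else 1#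

  vacant : Vertex → Vertex → Subset order → ℝ
  vacant v u I = if adjacent v u ∧ lookup I u then 0# else 1#

  ∏-penalty-nonNeg : ∀ v us I → 0# ≤ ∏ us (λ u → penalty v u I)
  ∏-penalty-nonNeg v us I = ∏-nonNeg us λ u → if-nonNeg (adjacent v u ∧ uncovered v u I)
    where
    if-nonNeg : ∀ b → 0# ≤ (if b then retention else 1#)
    if-nonNeg true  = ⁻¹-nonNeg 0<1+fugacity
    if-nonNeg false = 0≤1

  -- The invariant under which factors are exchanged: occupying a neighbour of `v` multiplies the
  -- weight by at most λ, and annihilates it if that neighbour is covered. An inequality is
  -- required, because `vacant` factors absorbed into the weight can drop from 1 to 0 under
  -- insertion.
  Dampable : Vertex → (Subset order → ℝ) → Set
  Dampable v w = (∀ I → 0# ≤ w I) ×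
    (∀ u I → v ~ u → lookup I u ≡ false → w (insert u I) ≤ 𝟙 (uncovered v u I) * (fugacity * w I))

  weight-dampable : ∀ v → Dampable v weight
  weight-dampable v = weight-nonNeg , λ u I v~u u∉I → begin
    weight (insert u I)                                   ≈⟨ weight-insert u I u∉I ⟩
    𝟙 (free u I) * (fugacity * weight I)
      ≤⟨ *-monoˡ-≤ (*-nonNeg 0≤fugacity (weight-nonNeg I)) (𝟙-mono-≤ (free? u I) (uncovered? v u I) λ fr t t∈I _ → fr t t∈I) ⟩
    𝟙 (uncovered v u I) * (fugacity * weight I)           ∎

  vacant-nonNeg : ∀ v u I → 0# ≤ vacant v u I
  vacant-nonNeg v u I with adjacent v u ∧ lookup I u
  ... | true  = ≤-refl
  ... | false = 0≤1

  vacant-insert≤ : ∀ v u s I → vacant v s (insert u I) ≤ vacant v s I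
  vacant-insert≤ v u s I with adjacent v s | s Fin.≟ u
  ... | false | _ = ≤-refl
  ... | true  | yes ≡.refl rewrite Vec.lookup∘update s I true with lookup I s
  ...   | true  = ≤-refl
  ...   | false = 0≤1
  vacant-insert≤ v u s I | true | no s≢u rewrite Vec.lookup∘update′ s≢u I true = ≤-refl

  dampable-vacant : ∀ v s {w} → Dampable v w → Dampable v (λ I → w I * vacant v s I)
  dampable-vacant v s {w} (w-nonNeg , w-insert) =
    (λ I → *-nonNeg (w-nonNeg I) (vacant-nonNeg v s I)) , λ u I v~u u∉I → begin
      w (insert u I) * vacant v s (insert u I)
        ≤⟨ *-mono-≤ (w-nonNeg (insert u I)) (vacant-nonNeg v s I) (w-insert u I v~u u∉I) (vacant-insert≤ v u s I) ⟩
      𝟙 (uncovered v u I) * (fugacity * w I) * vacant v s I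
        ≈⟨ solve 4 (λ b l w c → b :* (l :* w) :* c := b :* (l :* (w :* c))) refl (𝟙 (uncovered v u I)) fugacity (w I) (vacant v s I) ⟩
      𝟙 (uncovered v u I) * (fugacity * (w I * vacant v s I)) ∎

  -- Pairing I with I ∪ {u}: an uncovered u carries a factor 1 + fugacity, which the retention cancels.
  damp-one : ∀ v u {w} (P : Subset order → ℝ) → Dampable v w → (∀ I → 0# ≤ P I) →
             (∀ I → v ~ u → P (insert u I) ≈ P I) →
             ∑ (subsets order) (λ I → w I * (penalty v u I * P I)) ≤ ∑ (subsets order) (λ I → w I * vacant v u I * P I)
  damp-one v u {w} P (w-nonNeg , w-insert) P-nonNeg P-insert with v ~? u
  ... | no _    = ≤-reflexive (∑-cong (subsets order) λ I → sym (*-assoc _ _ _))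
  ... | yes v~u = ∑-toggle-≤ u toggle
    where
    factor : Bool → ℝ
    factor b = if b then retention else 1#
    toggle : ∀ I → lookup I u ≡ false →
      w I * (factor (uncovered v u I) * P I) + w (insert u I) * (factor (uncovered v u (insert u I)) * P (insert u I))
      ≤ w I * (if lookup I u then 0# else 1#) * P I + w (insert u I) * (if lookup (insert u I) u then 0# else 1#) * P (insert u I)
    toggle I u∉I rewrite u∉I | Vec.lookup∘update u I true | uncovered-insert v u u I v~u = begin
      w I * (factor b * P I) + w (insert u I) * (factor b * P (insert u I))
        ≈⟨ +-congˡ (*-congˡ (*-congˡ (P-insert I v~u))) ⟩
      w I * (factor b * P I) + w (insert u I) * (factor b * P I)
        ≤⟨ +-mono-≤ ≤-refl (*-monoˡ-≤ (*-nonNeg (factor-nonNeg b) (P-nonNeg I)) (w-insert u I v~u u∉I)) ⟩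
      w I * (factor b * P I) + 𝟙 b * (fugacity * w I) * (factor b * P I)
        ≈⟨ cancel b ⟩
      w I * P I
        ≈⟨ solve 4 (λ w p w′ p′ → w :* p := w :* :1 :* p :+ w′ :* :0 :* p′) refl (w I) (P I) (w (insert u I)) (P (insert u I)) ⟩
      w I * 1# * P I + w (insert u I) * 0# * P (insert u I) ∎
      where
      b = uncovered v u I
      factor-nonNeg : ∀ b → 0# ≤ factor b
      factor-nonNeg true  = ⁻¹-nonNeg 0<1+fugacity
      factor-nonNeg false = 0≤1
      cancel : ∀ b → w I * (factor b * P I) + 𝟙 b * (fugacity * w I) * (factor b * P I) ≈ w I * P I
      cancel false = solve 3 (λ l w p → w :* (:1 :* p) :+ :0 :* (l :* w) :* (:1 :* p) := w :* p) refl fugacity (w I) (P I)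
      cancel true  = trans
        (solve 4 (λ l w p r → w :* (r :* p) :+ :1 :* (l :* w) :* (r :* p) := (:1 :+ l) :* r :* (w :* p)) refl fugacity (w I) (P I) retention)
        (trans (*-congʳ (*-inverseʳ (0<⇒≉0 0<1+fugacity))) (*-identityˡ _))

  -- Each exchanged factor moves from the product into the weight, so the induction has to range
  -- over all dampable weights and not over `weight` alone.
  damp : ∀ v us {w} → Dampable v w →
         ∑ (subsets order) (λ I → w I * ∏ us (λ u → penalty v u I)) ≤ ∑ (subsets order) (λ I → w I * ∏ us (λ u → vacant v u I))
  damp v []       {w} dampable = ≤-refl
  damp v (u ∷ us) {w} dampable = begin
    _   ≤⟨ damp-one v u (λ I → ∏ us (λ s → penalty v s I)) dampable (∏-penalty-nonNeg v us)
             (λ I v~u → reflexive (∏-cong-≡ us λ s → ≡.cong (λ b → if adjacent v s ∧ b then retention else 1#) (uncovered-insert v u s I v~u))) ⟩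
    _   ≤⟨ damp v us (dampable-vacant v u dampable) ⟩
    _   ≈⟨ ∑-cong (subsets order) (λ I → *-assoc (w I) (vacant v u I) (∏ us (λ u → vacant v u I))) ⟩
    _   ∎

  ∏-vacant≤free : ∀ v I → ∏ (allFin order) (λ u → vacant v u I) ≤ 𝟙 (free v I)
  ∏-vacant≤free v I = ≤𝟙 (free? v I)
    (∏-≤1 (allFin order) (λ u → vacant-nonNeg v u I) (λ u → vacant-≤1 (adjacent v u ∧ lookup I u))) blocked
    where
    vacant-≤1 : ∀ b → (if b then 0# else 1#) ≤ 1#
    vacant-≤1 true  = 0≤1
    vacant-≤1 false = ≤-refl
    blocked : ¬ Free v I → ∏ (allFin order) (λ u → vacant v u I) ≤ 0#
    blocked ¬free with Fin.any? (λ t → (t ∈? I) ×-dec (v ~? t))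
    ... | no ¬blocked = ⊥-elim (¬free λ t t∈I v~t → ¬blocked (t , t∈I , v~t))
    ... | yes (t , t∈I , v~t) = ≤-reflexive (∏-zero (List∈.∈-allFin t)
            (reflexive (≡.cong₂ (λ b c → if b ∧ c then 0# else 1#) (dec-true (v ~? t) v~t) (Vec.[]=⇒lookup t∈I))))

  E-penalty≤unblocked : ∀ v → E (λ I → ∏ (allFin order) (λ u → penalty v u I)) ≤ unblocked v
  E-penalty≤unblocked v = ≤-trans (damp v (allFin order) (weight-dampable v)) (E-mono-≤ (∏-vacant≤free v))

  meanOccupied-nonNeg : 0# < fromℕ order → 0# ≤ (1# / fromℕ order) * 𝔼 fugacity (λ I → fromℕ ∣ I ∣)
  meanOccupied-nonNeg 0<n = *-nonNeg (*-nonNeg 0≤1 (⁻¹-nonNeg 0<n)) (≤-trans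
    (*-nonNeg (E-nonNeg λ I → fromℕ-nonNeg ∣ I ∣) (⁻¹-nonNeg 0<Z₁)) (≤-reflexive (sym (𝔼≈E/Z (λ I → fromℕ ∣ I ∣)))))

-- From the local estimate to the mean occupancy

module Occupancy (R : RealNumbers) where

  open RealNumbers R hiding (zero)
  open RealAnalysis R
  open RingSolver R
  open OrderedField R
  open FiniteSums R
  open ExponentialSeries R
  open ≤-Reasoning

  module Bounds
    {exp : ℝ → ℝ} (exp-def : IsExp exp) (G : Graph)
    {fugacity : ℝ} (0<fugacity : 0# < fugacity)
    {L : ℝ} (0≤L : 0# ≤ L) (exp-L : exp L ≈ 1# + fugacity)
    where

    open Graph G
    open Exponential exp-def
    open LocalOccupancy R G fugacity 0<fugacity
    open HardCore R G using (𝔼)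

    retention-exp : retention * exp L ≈ 1#
    retention-exp = trans (*-congˡ exp-L) (*-inverseˡ (0<⇒≉0 0<1+fugacity))

    -- The bound (1 + λ)^(-Y) ≥ e^(-L Y), multiplied out. Each true entry contributes
    -- `retention * exp L` = 1, and superadditivity merges e^L into the exponential of the remaining
    -- entries.
    ∏-retention : ∀ {A : Set} (xs : List A) (b : A → Bool) →
                  1# ≤ ∏ xs (λ x → if b x then retention else 1#) * exp (L * ∑ xs (λ x → 𝟙 (b x)))
    ∏-retention []       b = begin
      1#                    ≤⟨ 1≤exp-0 ⟩
      exp 0#                ≈⟨ exp-cong ≤-refl (sym (zeroʳ L)) ⟩
      exp (L * 0#)          ≈⟨ *-identityˡ _ ⟨
      1# * exp (L * 0#)     ∎
    ∏-retention (x ∷ xs) b with b x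
    ... | false = begin
      1#                               ≤⟨ ∏-retention xs b ⟩
      P * exp (L * Y)                  ≈⟨ *-cong (sym (*-identityˡ P)) (exp-cong (*-nonNeg 0≤L 0≤Y) (*-congˡ (sym (+-identityˡ Y)))) ⟩
      1# * P * exp (L * (0# + Y))      ∎
      where
      P = ∏ xs (λ x → if b x then retention else 1#)
      Y = ∑ xs (λ x → 𝟙 (b x))
      0≤Y : 0# ≤ Y
      0≤Y = ∑-nonNeg xs (λ x → 𝟙-nonNeg (b x))
    ... | true  = begin
      1#                                             ≤⟨ ∏-retention xs b ⟩
      P * exp (L * Y)                                ≈⟨ trans (sym (*-identityˡ _)) (*-congʳ (sym retention-exp)) ⟩
      retention * exp L * (P * exp (L * Y))
        ≈⟨ solve 4 (λ r e p y → r :* e :* (p :* y) := r :* p :* (e :* y)) refl retention (exp L) P (exp (L * Y)) ⟩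
      retention * P * (exp L * exp (L * Y))          ≤⟨ *-monoʳ-≤ (*-nonNeg (⁻¹-nonNeg 0<1+fugacity) 0≤P) (exp-superadditive 0≤L (*-nonNeg 0≤L 0≤Y)) ⟩
      retention * P * exp (L + L * Y)
        ≈⟨ *-congˡ (exp-cong (+-nonNeg 0≤L (*-nonNeg 0≤L 0≤Y)) (solve 2 (λ l y → l :+ l :* y := l :* (:1 :+ y)) refl L Y)) ⟩
      retention * P * exp (L * (1# + Y))             ∎
      where
      P = ∏ xs (λ x → if b x then retention else 1#)
      Y = ∑ xs (λ x → 𝟙 (b x))
      0≤Y : 0# ≤ Y
      0≤Y = ∑-nonNeg xs (λ x → 𝟙-nonNeg (b x))
      if-nonNeg : ∀ b → 0# ≤ (if b then retention else 1#)
      if-nonNeg true  = ⁻¹-nonNeg 0<1+fugacity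
      if-nonNeg false = 0≤1
      0≤P : 0# ≤ P
      0≤P = ∏-nonNeg xs (λ x → if-nonNeg (b x))

    uncoveredNeighbours : Vertex → Subset order → ℝ
    uncoveredNeighbours v I = ∑ (allFin order) λ u → 𝟙 (adjacent v u ∧ uncovered v u I)

    module _ {w : ℝ} (0≤w : 0# ≤ w) where

      -- With P the product of penalties, (1 + w - L Y) e^(L Y) ≤ e^w is multiplied by P and
      -- combined with 1 ≤ P e^(L Y). The combination requires 1 + w - L Y ≥ 0; otherwise the right
      -- side wins by its sign. The left side is spelled so that linearity of `E` turns it into (1 +
      -- w) Z - L E Y.
      affine≤penalty : ∀ v I → (1# + w) * 1# + - L * uncoveredNeighbours v I
                               ≤ exp w * ∏ (allFin order) (λ u → penalty v u I)
      affine≤penalty v I with total 0# (1# + (w - L * uncoveredNeighbours v I))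
      ... | inj₁ 0≤a = begin
        (1# + w) * 1# + - L * Y            ≈⟨ solve 3 (λ w l y → (:1 :+ w) :* :1 :+ (:- l) :* y := (:1 :+ (w :- l :* y)) :* :1) refl w L Y ⟩
        (1# + (w - L * Y)) * 1#            ≤⟨ *-monoʳ-≤ 0≤a (∏-retention (allFin order) (λ u → adjacent v u ∧ uncovered v u I)) ⟩
        (1# + (w - L * Y)) * (P * exp (L * Y))
          ≈⟨ solve 3 (λ a p e → a :* (p :* e) := a :* e :* p) refl (1# + (w - L * Y)) P (exp (L * Y)) ⟩
        (1# + (w - L * Y)) * exp (L * Y) * P
          ≤⟨ *-monoˡ-≤ (∏-penalty-nonNeg v (allFin order) I) (exp-tangent 0≤w (*-nonNeg 0≤L (∑-nonNeg (allFin order) λ u → 𝟙-nonNeg (adjacent v u ∧ uncovered v u I)))) ⟩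
        exp w * P                          ∎
        where
        Y = uncoveredNeighbours v I
        P = ∏ (allFin order) (λ u → penalty v u I)
      ... | inj₂ a≤0 = begin
        (1# + w) * 1# + - L * Y            ≈⟨ solve 3 (λ w l y → (:1 :+ w) :* :1 :+ (:- l) :* y := :1 :+ (w :- l :* y)) refl w L Y ⟩
        1# + (w - L * Y)                   ≤⟨ a≤0 ⟩
        0#                                 ≤⟨ *-nonNeg (<⇒≤ (0<exp 0≤w)) (∏-penalty-nonNeg v (allFin order) I) ⟩
        exp w * _                          ∎
        where
        Y = uncoveredNeighbours v I

      Z≤unblocked+uncovered : ∀ v → (1# + w) * Z₁ ≤ exp w * unblocked v + L * E (uncoveredNeighbours v)
      Z≤unblocked+uncovered v = begin
        (1# + w) * Z₁
          ≈⟨ solve 3 (λ z l y → z := (z :+ (:- l) :* y) :+ l :* y) refl ((1# + w) * Z₁) L Y ⟩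
        ((1# + w) * Z₁ + - L * Y) + L * Y
          ≈⟨ +-congʳ (trans (E-+ _ _) (+-cong (E-*ˡ (1# + w) _) (E-*ˡ (- L) _))) ⟨
        E (λ I → (1# + w) * 1# + - L * uncoveredNeighbours v I) + L * Y
          ≤⟨ +-monoˡ-≤ _ (≤-trans (E-mono-≤ (affine≤penalty v)) (≤-trans (≤-reflexive (E-*ˡ (exp w) _))
               (*-monoʳ-≤ (<⇒≤ (0<exp 0≤w)) (E-penalty≤unblocked v)))) ⟩
        exp w * unblocked v + L * Y ∎
        where Y = E (uncoveredNeighbours v)

    -- This is λ / (1 + λ) ≤ log (1 + λ): the tangent to exp at L, evaluated at 0, gives (1 - L)(1 +
    -- λ) ≤ 1.
    fugacity≤ : fugacity ≤ (1# + fugacity) * L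
    fugacity≤ = ≤-byDifference (≤⇒0≤- below)
      (solve 2 (λ f l → f :+ (:1 :- (:1 :+ (:0 :- l)) :* (:1 :+ f)) := (:1 :+ f) :* l) refl fugacity L)
      where
      below : (1# + (0# - L)) * (1# + fugacity) ≤ 1#
      below = ≤-trans (≤-reflexive (*-congˡ (sym exp-L))) (≤-trans (exp-tangent ≤-refl 0≤L) exp-0≤1)

    occupied≤ : ∀ t → occupied t ≤ L * Z₁
    occupied≤ t = *-cancelˡ-≤ 0<1+fugacity (begin
      (1# + fugacity) * occupied t    ≈⟨ occupied-unblocked t ⟩
      fugacity * unblocked t          ≤⟨ *-monoʳ-≤ 0≤fugacity (unblocked≤Z t) ⟩
      fugacity * Z₁                   ≤⟨ *-monoˡ-≤ (<⇒≤ 0<Z₁) fugacity≤ ⟩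
      (1# + fugacity) * L * Z₁        ≈⟨ *-assoc _ _ _ ⟩
      (1# + fugacity) * (L * Z₁)      ∎)

    unblockedNeighbours : Vertex → ℝ
    unblockedNeighbours v = ∑ (allFin order) λ u → 𝟙 (adjacent v u) * unblocked u

    𝟙-∧ : ∀ b c → 𝟙 (b ∧ c) ≈ 𝟙 b * 𝟙 c
    𝟙-∧ true  c = sym (*-identityˡ _)
    𝟙-∧ false c = sym (zeroˡ _)

    E-uncoveredNeighbours≤ : ∀ v → E (uncoveredNeighbours v) ≤ unblockedNeighbours v + L * Z₁ * triangles v
    E-uncoveredNeighbours≤ v = begin
      E (uncoveredNeighbours v)  ≈⟨ E-∑ (allFin order) _ ⟩
      ∑ (allFin order) (λ u → E (λ I → 𝟙 (adjacent v u ∧ uncovered v u I)))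
        ≈⟨ ∑-cong (allFin order) (λ u → trans (E-cong λ I → 𝟙-∧ (adjacent v u) (uncovered v u I)) (E-*ˡ (𝟙 (adjacent v u)) _)) ⟩
      ∑ (allFin order) (λ u → 𝟙 (adjacent v u) * E (λ I → 𝟙 (uncovered v u I)))
        ≤⟨ ∑-mono-≤ (allFin order) (λ u → *-monoʳ-≤ (𝟙-nonNeg (adjacent v u)) (≤-trans (uncovered≤ v u)
             (+-mono-≤ ≤-refl (∑-mono-≤ (allFin order) λ t →
               *-monoʳ-≤ (*-nonNeg (𝟙-nonNeg (adjacent u t)) (𝟙-nonNeg (adjacent v t))) (occupied≤ t))))) ⟩
      ∑ (allFin order) (λ u → 𝟙 (adjacent v u) * (unblocked u + ∑ (allFin order) (λ t → common u t * (L * Z₁))))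
        ≈⟨ ∑-cong (allFin order) (λ u → trans (distribˡ _ _ _) (+-congˡ (pull u))) ⟩
      ∑ (allFin order) (λ u → 𝟙 (adjacent v u) * unblocked u + L * Z₁ * ∑ (allFin order) (λ t → 𝟙 (adjacent v u) * common u t))
        ≈⟨ trans (∑-+ (allFin order) _ _) (+-congˡ (∑-*ˡ (allFin order) (L * Z₁) _)) ⟩
      unblockedNeighbours v + L * Z₁ * triangles v ∎
      where
      common : Vertex → Vertex → ℝ
      common u t = 𝟙 (adjacent u t) * 𝟙 (adjacent v t)
      pull : ∀ u → 𝟙 (adjacent v u) * ∑ (allFin order) (λ t → common u t * (L * Z₁))
                   ≈ L * Z₁ * ∑ (allFin order) (λ t → 𝟙 (adjacent v u) * common u t)
      pull u = trans (sym (∑-*ˡ (allFin order) (𝟙 (adjacent v u)) _)) (trans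
        (∑-cong (allFin order) λ t → solve 3 (λ a c l → a :* (c :* l) := l :* (a :* c)) refl (𝟙 (adjacent v u)) (common u t) (L * Z₁))
        (∑-*ˡ (allFin order) (L * Z₁) _))

    totalUnblocked : ℝ
    totalUnblocked = ∑ (allFin order) unblocked

    degree≤maxDegree : ∀ u → degree u ℕ.≤ maxDegree
    degree≤maxDegree u = All.lookup (xs≤max 0 (List.map degree (allFin order))) (List∈.∈-map⁺ degree (List∈.∈-allFin u))

    -- Double counting: after the sums are swapped, each u occurs once for every neighbour.
    ∑-unblockedNeighbours≤ : ∑ (allFin order) unblockedNeighbours ≤ fromℕ maxDegree * totalUnblocked
    ∑-unblockedNeighbours≤ = begin
      ∑ (allFin order) unblockedNeighbours
        ≈⟨ ∑-swap (allFin order) (allFin order) (λ v u → 𝟙 (adjacent v u) * unblocked u) ⟩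
      ∑ (allFin order) (λ u → ∑ (allFin order) (λ v → 𝟙 (adjacent v u) * unblocked u))
        ≤⟨ ∑-mono-≤ (allFin order) bound ⟩
      ∑ (allFin order) (λ u → fromℕ maxDegree * unblocked u)
        ≈⟨ ∑-*ˡ (allFin order) (fromℕ maxDegree) unblocked ⟩
      fromℕ maxDegree * totalUnblocked ∎
      where
      bound : ∀ u → ∑ (allFin order) (λ v → 𝟙 (adjacent v u) * unblocked u) ≤ fromℕ maxDegree * unblocked u
      bound u = begin
        ∑ (allFin order) (λ v → 𝟙 (adjacent v u) * unblocked u)
          ≈⟨ ∑-cong (allFin order) (λ v → trans (*-comm _ _) (*-congˡ (reflexive (≡.cong 𝟙 (adjacent-sym v u))))) ⟩
        ∑ (allFin order) (λ v → unblocked u * 𝟙 (adjacent u v))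
          ≈⟨ trans (∑-*ˡ (allFin order) (unblocked u) _) (*-comm _ _) ⟩
        ∑ (allFin order) (λ v → 𝟙 (adjacent u v)) * unblocked u
          ≈⟨ *-congʳ (fromℕ-degree u) ⟨
        fromℕ (degree u) * unblocked u
          ≤⟨ *-monoˡ-≤ (E-nonNeg λ I → 𝟙-nonNeg (free u I)) (fromℕ-mono-≤ (degree≤maxDegree u)) ⟩
        fromℕ maxDegree * unblocked u ∎

    ∑-vertices-const : ∀ c → ∑ (allFin order) (λ _ → c) ≈ fromℕ order * c
    ∑-vertices-const c = trans (∑-const (allFin order) c) (*-congʳ (reflexive (≡.cong fromℕ (List.length-tabulate {n = order} (λ u → u)))))

    -- Summing over v leaves T with coefficient e^w + Δ L, and the equation for `w` turns this into
    -- (1 + w) e^w.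
    totalUnblocked-bound : ∀ {w M} → 0# ≤ w → w * exp w ≈ fromℕ maxDegree * L →
      (∀ v → fromℕ (length (inducedEdges (neighbourhood v))) ≤ M) →
      fromℕ order * Z₁ * ((1# + w) - (1# + 1#) * M * L * L) ≤ (1# + w) * (exp w * totalUnblocked)
    totalUnblocked-bound {w} {M} 0≤w w-exp edges≤ = 0≤-⇒≤ (≤-trans (≤⇒0≤- summed) (≤-reflexive (begin-equality
      (exp w * T + L * (fromℕ maxDegree * T + n * c)) - n * ((1# + w) * Z₁)
        ≈⟨ solve 8 (λ e t l d n m z w → (e :* t :+ l :* (d :* t :+ n :* (l :* z :* ((:1 :+ :1) :* m)))) :- n :* ((:1 :+ w) :* z)
               := (e :+ d :* l) :* t :- n :* z :* ((:1 :+ w) :- (:1 :+ :1) :* m :* l :* l)) refl (exp w) T L (fromℕ maxDegree) n M Z₁ w ⟩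
      (exp w + fromℕ maxDegree * L) * T - lhs
        ≈⟨ +-congʳ (*-congʳ (+-congˡ w-exp)) ⟨
      (exp w + w * exp w) * T - lhs
        ≈⟨ +-congʳ (solve 3 (λ e w t → (e :+ w :* e) :* t := (:1 :+ w) :* (e :* t)) refl (exp w) w T) ⟩
      (1# + w) * (exp w * T) - lhs ∎)))
      where
      n = fromℕ order
      T = totalUnblocked
      c = L * Z₁ * ((1# + 1#) * M)
      lhs = n * Z₁ * ((1# + w) - (1# + 1#) * M * L * L)
      vertex : ∀ v → (1# + w) * Z₁ ≤ exp w * unblocked v + L * (unblockedNeighbours v + c)
      vertex v = ≤-trans (Z≤unblocked+uncovered 0≤w v) (+-mono-≤ ≤-refl (*-monoʳ-≤ 0≤L
        (≤-trans (E-uncoveredNeighbours≤ v) (+-mono-≤ ≤-refl (*-monoʳ-≤ (*-nonNeg 0≤L (<⇒≤ 0<Z₁))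
          (≤-trans (triangles≤ v) (*-monoʳ-≤ (+-nonNeg 0≤1 0≤1) (edges≤ v))))))))
      summed : n * ((1# + w) * Z₁) ≤ exp w * T + L * (fromℕ maxDegree * T + n * c)
      summed = begin
        n * ((1# + w) * Z₁)                            ≈⟨ ∑-vertices-const _ ⟨
        ∑ (allFin order) (λ _ → (1# + w) * Z₁)         ≤⟨ ∑-mono-≤ (allFin order) vertex ⟩
        ∑ (allFin order) (λ v → exp w * unblocked v + L * (unblockedNeighbours v + c))
          ≈⟨ trans (∑-+ (allFin order) _ _) (+-cong (∑-*ˡ (allFin order) (exp w) unblocked)
               (trans (∑-*ˡ (allFin order) L _) (*-congˡ (trans (∑-+ (allFin order) unblockedNeighbours _) (+-congˡ (∑-vertices-const c)))))) ⟩
        exp w * T + L * (∑ (allFin order) unblockedNeighbours + n * c)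
          ≤⟨ +-mono-≤ ≤-refl (*-monoʳ-≤ 0≤L (+-monoˡ-≤ _ ∑-unblockedNeighbours≤)) ⟩
        exp w * T + L * (fromℕ maxDegree * T + n * c) ∎

    meanOccupied-bound : 0# < fromℕ order → ∀ {w D M η} → 0# < w → 0# < D → 0# ≤ η →
      w * exp w ≈ D → fromℕ maxDegree * L ≈ D → (1# + 1#) * M * L * L ≈ η * w →
      (∀ v → fromℕ (length (inducedEdges (neighbourhood v))) ≤ M) →
      (1# - η) * (fugacity / (1# + fugacity)) * (w / D) ≤ (1# / fromℕ order) * 𝔼 fugacity (λ I → fromℕ ∣ I ∣)
    meanOccupied-bound 0<n {w} {D} {M} {η} 0<w 0<D 0≤η w-exp ΔL≈D defect edges≤ =
      -- All inverses are cleared at once. What remains is `total-bound` multiplied by λ w, by means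
      -- of w e^w = D and λ T = (1 + λ) X.
      *-cancelˡ-≤ (*-pos (*-pos 0<1+fugacity 0<D) (*-pos 0<n 0<Z₁)) (begin
        (1+λ * D) * (n * Z₁) * ((1# - η) * (fugacity / 1+λ) * (w / D))
          ≈⟨ solve 9 (λ p q d e n z h l w → (p :* d) :* (n :* z) :* ((:1 :- h) :* (l :* q) :* (w :* e))
                                          := (p :* q) :* (d :* e) :* (l :* w :* ((:1 :- h) :* (n :* z))))
                     refl 1+λ (1+λ ⁻¹) D (D ⁻¹) n Z₁ η fugacity w ⟩
        (1+λ * 1+λ ⁻¹) * (D * D ⁻¹) * (fugacity * w * ((1# - η) * (n * Z₁)))
          ≈⟨ units (*-inverseʳ (0<⇒≉0 0<1+fugacity)) (*-inverseʳ (0<⇒≉0 0<D)) ⟩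
        fugacity * w * ((1# - η) * (n * Z₁))
          ≤⟨ *-monoʳ-≤ (*-nonNeg 0≤fugacity (<⇒≤ 0<w)) total-bound ⟩
        fugacity * w * (exp w * T)
          ≈⟨ solve 4 (λ l w e t → l :* w :* (e :* t) := w :* e :* (l :* t)) refl fugacity w (exp w) T ⟩
        w * exp w * (fugacity * T)
          ≈⟨ *-cong w-exp total-occupied ⟩
        D * (1+λ * X)
          ≈⟨ units (*-inverseʳ (0<⇒≉0 0<n)) (*-inverseʳ (0<⇒≉0 0<Z₁)) ⟨
        (n * n ⁻¹) * (Z₁ * Z₁ ⁻¹) * (D * (1+λ * X))
          ≈⟨ solve 7 (λ p d n m z y x → (n :* m) :* (z :* y) :* (d :* (p :* x)) := (p :* d) :* (n :* z) :* (:1 :* m :* (x :* y)))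
                     refl 1+λ D n (n ⁻¹) Z₁ (Z₁ ⁻¹) X ⟩
        (1+λ * D) * (n * Z₁) * ((1# / n) * (X / Z₁))
          ≈⟨ *-congˡ (*-congˡ (𝔼≈E/Z (λ I → fromℕ ∣ I ∣))) ⟨
        (1+λ * D) * (n * Z₁) * ((1# / n) * 𝔼 fugacity (λ I → fromℕ ∣ I ∣)) ∎)
      where
      n = fromℕ order
      T = totalUnblocked
      1+λ = 1# + fugacity
      X = E (λ I → fromℕ ∣ I ∣)
      units : ∀ {a b c} → a ≈ 1# → b ≈ 1# → a * b * c ≈ c
      units {c = c} a≈1 b≈1 = trans (*-congʳ (*-cong a≈1 b≈1)) (solve 1 (λ c → :1 :* :1 :* c := c) refl c)
      total-occupied : fugacity * T ≈ 1+λ * X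
      total-occupied = begin-equality
        fugacity * T                                          ≈⟨ ∑-*ˡ (allFin order) fugacity unblocked ⟨
        ∑ (allFin order) (λ u → fugacity * unblocked u)       ≈⟨ ∑-cong (allFin order) (λ u → sym (occupied-unblocked u)) ⟩
        ∑ (allFin order) (λ u → 1+λ * occupied u)             ≈⟨ ∑-*ˡ (allFin order) 1+λ occupied ⟩
        1+λ * ∑ (allFin order) occupied                       ≈⟨ *-congˡ E-∣∣ ⟨
        1+λ * X                                               ∎
      total-bound : (1# - η) * (n * Z₁) ≤ exp w * T
      total-bound = *-cancelˡ-≤ (+-pos-nonNeg 0<1 (<⇒≤ 0<w)) (begin
        (1# + w) * ((1# - η) * (n * Z₁))
          -- The relative defect is η w / (1 + w), which is at most η.
          ≤⟨ ≤-byDifference (*-nonNeg 0≤η (*-nonNeg (<⇒≤ 0<n) (<⇒≤ 0<Z₁)))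
               (solve 3 (λ w h nz → (:1 :+ w) :* ((:1 :- h) :* nz) :+ h :* nz := nz :* ((:1 :+ w) :- h :* w)) refl w η (n * Z₁)) ⟩
        n * Z₁ * ((1# + w) - η * w)
          ≈⟨ *-congˡ (+-congˡ (-‿cong defect)) ⟨
        n * Z₁ * ((1# + w) - (1# + 1#) * M * L * L)
          ≤⟨ totalUnblocked-bound (<⇒≤ 0<w) (trans w-exp (sym ΔL≈D)) edges≤ ⟩
        (1# + w) * (exp w * T) ∎)

-- The graph without vertices has maximum degree 0 by computation, so Δ ≥ 1 makes 1 / n a genuine
-- inverse.
1≤order : ∀ (G : Graph) → 1 ℕ.≤ Graph.maxDegree G → 1 ℕ.≤ Graph.order G
1≤order record { order = suc _ } _ = ℕ.s≤s ℕ.z≤n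

-- The error function δ and the dependence on f

module Shortfall (R : RealNumbers) (E : ElementaryFunctions R) where

  open RealNumbers R hiding (zero)
  open RealAnalysis R
  open ElementaryFunctions E
  open RingSolver R
  open OrderedField R
  open ≤-Reasoning

  module Family
    (Δ : Func ℝ-setoid (setoid ℕ)) (fugacity : Func ℝ-setoid ℝ-setoid)
    (1≤Δ : ∀ f → 0# < f → 1 ℕ.≤ Δ ⟨$⟩ f)
    (0<fugacity : ∀ f → 0# < f → 0# < fugacity ⟨$⟩ f)
    where

    logTerm : ℝ → ℝ
    logTerm f = log (1# + (fugacity ⟨$⟩ f))

    Δlog : ℝ → ℝ
    Δlog f = fromℕ (Δ ⟨$⟩ f) * logTerm f

    w : ℝ → ℝ
    w f = W (Δlog f)

    η : ℝ → ℝ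
    η f = (fromℕ 2 * Δlog f ^ 2) / (f * w f)

    0<exp : ∀ x → 0# < exp x
    0<exp x = InverseOn.f-maps log-def {x} tt

    W-domain : ∀ {y} → 0# < y → - (1# / exp 1#) ≤ y
    W-domain {y} 0<y = begin
      - (1# / exp 1#)   ≤⟨ neg-mono-≤ (*-nonNeg 0≤1 (⁻¹-nonNeg (0<exp 1#))) ⟩
      - 0#              ≈⟨ solve 0 (:- :0 := :0) refl ⟩
      0#                ≤⟨ <⇒≤ 0<y ⟩
      y                 ∎

    W-exp : ∀ {y} → 0# < y → W y * exp (W y) ≈ y
    W-exp 0<y = InverseOn.inverseˡ W-def (W-domain 0<y)

    -- A priori `W y` may lie anywhere in [-1,∞), so this rests on positivity of `exp` on the whole
    -- line, which comes from `log-def` and not from the series.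
    0<W : ∀ {y} → 0# < y → 0# < W y
    0<W {y} 0<y = ≰⇒> λ W≤0 → <⇒≱ 0<y (begin
      y                   ≈⟨ W-exp 0<y ⟨
      W y * exp (W y)     ≤⟨ *-monoˡ-≤ (<⇒≤ (0<exp (W y))) W≤0 ⟩
      0# * exp (W y)      ≈⟨ zeroˡ _ ⟩
      0#                  ∎)

    0<1+fugacity : ∀ f → 0# < f → 0# < 1# + (fugacity ⟨$⟩ f)
    0<1+fugacity f 0<f = +-pos-nonNeg 0<1 (<⇒≤ (0<fugacity f 0<f))

    exp-logTerm : ∀ f → 0# < f → exp (logTerm f) ≈ 1# + (fugacity ⟨$⟩ f)
    exp-logTerm f 0<f = InverseOn.inverseˡ log-def (0<1+fugacity f 0<f)

    module _ (F : ℝ) (0≤F : 0# ≤ F) (0<Δlog : ∀ f → F < f → 0# < Δlog f) where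

      positive : ∀ {f} → F < f → 0# < f
      positive = ≤-<-trans 0≤F

      -- The sign of the logarithm is read off from Δ log (1 + λ) > 0 by cancelling Δ ≥ 1.
      0≤logTerm : ∀ {f} → F < f → 0# ≤ logTerm f
      0≤logTerm {f} F<f = *-cancelˡ-≤ (fromℕ-pos (1≤Δ f (positive F<f)))
        (≤-trans (≤-reflexive (zeroʳ _)) (<⇒≤ (0<Δlog f F<f)))

      0<w : ∀ {f} → F < f → 0# < w f
      0<w F<f = 0<W (0<Δlog _ F<f)

      0≤η : ∀ {f} → F < f → 0# ≤ η f
      0≤η {f} F<f = *-nonNeg (*-nonNeg (fromℕ-nonNeg 2) (*-nonNeg 0≤D (*-nonNeg 0≤D 0≤1)))
                             (⁻¹-nonNeg (*-pos (positive F<f) (0<w F<f)))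
        where 0≤D = <⇒≤ (0<Δlog f F<f)

      Δlog-cong : ∀ {f g} → F < f → F < g → f ≈ g → Δlog f ≈ Δlog g
      Δlog-cong F<f F<g f≈g = *-cong (reflexive (≡.cong fromℕ (Func.cong Δ f≈g)))
        (InverseOn.g-cong log-def (0<1+fugacity _ (positive F<f)) (0<1+fugacity _ (positive F<g)) (+-congˡ (Func.cong fugacity f≈g)))

      -- Congruence of `log` and `W` is known on their domains only, and beyond `F` their arguments
      -- lie there. This makes `δ` a function on the setoid of reals.
      η-cong : ∀ {f g} → F < f → F < g → f ≈ g → η f ≈ η g
      η-cong F<f F<g f≈g = *-cong (*-congˡ (*-cong D≈ (*-congʳ D≈))) (⁻¹-cong (*-cong f≈g
        (InverseOn.g-cong W-def (W-domain (0<Δlog _ F<f)) (W-domain (0<Δlog _ F<g)) D≈)))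
        where D≈ = Δlog-cong F<f F<g f≈g

      η-defect : ∀ {f} → F < f →
                 (1# + 1#) * (fromℕ (Δ ⟨$⟩ f) ^ 2 / f) * logTerm f * logTerm f ≈ η f * w f
      η-defect {f} F<f = begin-equality
        (1# + 1#) * (d ^ 2 * f ⁻¹) * L * L
          ≈⟨ *-identityʳ _ ⟨
        (1# + 1#) * (d ^ 2 * f ⁻¹) * L * L * 1#
          ≈⟨ *-congˡ (*-inverseˡ (0<⇒≉0 (0<w F<f))) ⟨
        (1# + 1#) * (d ^ 2 * f ⁻¹) * L * L * (w f ⁻¹ * w f)
          ≈⟨ solve 5 (λ d i l u w → (:1 :+ :1) :* (d :* (d :* :1) :* i) :* l :* l :* (u :* w)
                                    := (:1 :+ (:1 :+ :0)) :* ((d :* l) :* ((d :* l) :* :1)) :* (i :* u) :* w)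
                     refl d (f ⁻¹) L (w f ⁻¹) (w f) ⟩
        (fromℕ 2 * Δlog f ^ 2) * (f ⁻¹ * w f ⁻¹) * w f
          ≈⟨ *-congʳ (*-congˡ (⁻¹-distrib-* (positive F<f) (0<w F<f))) ⟨
        η f * w f ∎
        where
        d = fromℕ (Δ ⟨$⟩ f)
        L = logTerm f

      -- Up to F, where log (1 + λ) and W are not known to be positive, −1 makes the claim trivial.
      δ-by : ∀ f → Dec (f ≤ F) → ℝ
      δ-by f (yes _) = - 1#
      δ-by f (no _)  = - η f

      δ-by-cong : ∀ {f g} f? g? → f ≈ g → δ-by f f? ≈ δ-by g g?
      δ-by-cong (yes _)   (yes _)   f≈g = refl
      δ-by-cong (yes f≤F) (no g≰F)  f≈g = ⊥-elim (g≰F (≤-trans (≤-reflexive (sym f≈g)) f≤F))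
      δ-by-cong (no f≰F)  (yes g≤F) f≈g = ⊥-elim (f≰F (≤-trans (≤-reflexive f≈g) g≤F))
      δ-by-cong (no f≰F)  (no g≰F)  f≈g = -‿cong (η-cong (≰⇒> f≰F) (≰⇒> g≰F) f≈g)

      δ : Func ℝ-setoid ℝ-setoid
      δ = record { to = λ f → δ-by f (f ≤? F) ; cong = λ {f} {g} → δ-by-cong (f ≤? F) (g ≤? F) }

      δ-tendsToZero : TendsToZero η → TendsToZero (δ ⟨$⟩_)
      δ-tendsToZero η→0 ε 0<ε with η→0 ε 0<ε
      ... | F′ , small with common-upper F F′
      ...   | M , F≤M , F′≤M = M , λ f M<f → close f (f ≤? F) (≤-<-trans F≤M M<f) (small f (≤-<-trans F′≤M M<f))
        where
        close : ∀ f f? → F < f → ∣ η f ∣< ε → ∣ δ-by f f? ∣< ε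
        close f (yes f≤F) F<f _ = ⊥-elim (<⇒≱ F<f f≤F)
        close f (no _) _ (above , below) = neg-mono-< below , (begin-strict
          - η f    <⟨ neg-mono-< above ⟩
          - - ε    ≈⟨ solve 1 (λ e → :- :- e := e) refl ε ⟩
          ε        ∎)

      module _ (f : ℝ) (0<f : 0# < f) (G : Graph) where
        open Graph G
        open HardCore R G

        occupancy : maxDegree ≡ Δ ⟨$⟩ f →
          (∀ v → fromℕ (length (inducedEdges (neighbourhood v))) ≤ fromℕ (Δ ⟨$⟩ f) ^ 2 / f) →
          (1# + (δ ⟨$⟩ f)) * ((fugacity ⟨$⟩ f) / (1# + (fugacity ⟨$⟩ f))) * (W (Δlog f) / Δlog f)
            ≤ (1# / fromℕ order) * 𝔼 (fugacity ⟨$⟩ f) (λ I → fromℕ ∣ I ∣)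
        occupancy maxDegree≡Δ edges≤ = by (f ≤? F)
          where
          l = fugacity ⟨$⟩ f
          0<n : 0# < fromℕ order
          0<n = fromℕ-pos (1≤order G (ℕ.≤-trans (1≤Δ f 0<f) (ℕ.≤-reflexive (≡.sym maxDegree≡Δ))))
          by : ∀ f? → (1# + δ-by f f?) * (l / (1# + l)) * (W (Δlog f) / Δlog f)
                      ≤ (1# / fromℕ order) * 𝔼 l (λ I → fromℕ ∣ I ∣)
          by (yes _) = begin
            (1# - 1#) * (l / (1# + l)) * (W (Δlog f) / Δlog f)
              ≈⟨ solve 2 (λ a b → (:1 :- :1) :* a :* b := :0) refl (l / (1# + l)) (W (Δlog f) / Δlog f) ⟩
            0#
              ≤⟨ LocalOccupancy.meanOccupied-nonNeg R G l (0<fugacity f 0<f) 0<n ⟩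
            _ ∎
          by (no f≰F) = Occupancy.Bounds.meanOccupied-bound R exp-def G (0<fugacity f 0<f) (0≤logTerm F<f) (exp-logTerm f 0<f) 0<n
            (0<w F<f) (0<Δlog f F<f) (0≤η F<f) (W-exp (0<Δlog f F<f)) (*-congʳ (reflexive (≡.cong fromℕ maxDegree≡Δ))) (η-defect F<f) edges≤
            where F<f = ≰⇒> f≰F

theorem2p1 :
    (R : RealNumbers) (E : ElementaryFunctions R) →
    let open RealNumbers R
        open RealAnalysis R
        open ElementaryFunctions E
    in
    (Δ : Func ℝ-setoid (setoid ℕ)) (fugacity : Func ℝ-setoid ℝ-setoid) →
    let Δ⟨_⟩ : ℝ → ℝ
        Δ⟨_⟩ f = fromℕ (Δ ⟨$⟩ f)
        λ⟨_⟩ : ℝ → ℝ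
        λ⟨_⟩ f = fugacity ⟨$⟩ f
        Δlog : ℝ → ℝ
        Δlog f = Δ⟨ f ⟩ * log (1# + λ⟨ f ⟩)
    in
    (∀ f → 0# < f → 1 ℕ.≤ Δ ⟨$⟩ f) →
    (∀ f → 0# < f → 0# < λ⟨ f ⟩) →
    (∀ f → 0# < f → f ≤ Δ⟨ f ⟩ ^ 2 + 1#) →
    TendsToInfinity Δlog →
    TendsToZero (λ f → (fromℕ 2 * Δlog f ^ 2) / (f * W (Δlog f))) →
    Σ[ δ ∈ Func ℝ-setoid ℝ-setoid ] TendsToZero (δ ⟨$⟩_) ×
      (∀ f → 0# < f → (G : Graph) →
        let open Graph G
            open HardCore R G
        in
        maxDegree ≡ Δ ⟨$⟩ f →
        (∀ v → fromℕ (length (inducedEdges (neighbourhood v))) ≤ Δ⟨ f ⟩ ^ 2 / f) →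
        (1# + (δ ⟨$⟩ f)) * (λ⟨ f ⟩ / (1# + λ⟨ f ⟩)) * (W (Δlog f) / Δlog f)
          ≤ (1# / fromℕ order) * 𝔼 λ⟨ f ⟩ (λ I → fromℕ ∣ I ∣))
theorem2p1 R E Δ fugacity 1≤Δ 0<fugacity _ Δlog→∞ η→0 =
  let open RealNumbers R
      open OrderedField R
      open Shortfall.Family R E Δ fugacity 1≤Δ 0<fugacity
      (F₀ , 0<Δlog)     = Δlog→∞ 0#
      -- Raising the threshold to at least 0 makes both f and Δ log (1 + λ) positive beyond it.
      (F , 0≤F , F₀≤F)  = common-upper 0# F₀
      0<Δlog′           = λ f F<f → 0<Δlog f (≤-<-trans F₀≤F F<f)
  in δ F 0≤F 0<Δlog′ , δ-tendsToZero F 0≤F 0<Δlog′ η→0 , occupancy F 0≤F 0<Δlog′
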